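{- Let $K\subset L$ be commutative fields such that every element of $L$ that is algebraic over $K$ is separable over $K$. Let $B$ be a finite-dimensional $K$-subspace of $L$ containing $1$, and let $n\geq1$. Then either $\langle B^{n+1}\rangle=\langle B^n\rangle$ or $$\dim_K\langle B^{n+1}\rangle\geq\dim_K\langle B^{n-1}\rangle+\dim_KB.$$
   Context: For $S\subset L$, $\langle S\rangle$ denotes the $K$-subspace of $L$ spanned by $S$. $B^m=\{b_1\cdots b_m\mid b_i\in B\}$ is the $m$-fold product set for $m\geq1$, and by convention $\langle B^0\rangle=K$. -}

module Defs where

open import Level using (Level; _⊔_) renaming (suc to lsuc)
open import Algebra.Apartness.Bundles using (HeytingCommutativeRing; HeytingField)
open import Algebra.Bundles using (CommutativeRing)
import Algebra.Definitions.RawMonoid as RawMonoidOps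
open import Algebra.Morphism.Structures using (module RingMorphisms)
open import Data.Fin.Base using (Fin; zero; suc)
open import Data.List.Base using (List; []; _∷_; map; foldr)
open import Data.Nat.Base using (ℕ; zero; suc; _≤_; _<_)
open import Data.Product.Base using (∃-syntax; _×_; _,_)
open import Function.Base using (_∘_)
open import Relation.Nullary.Negation.Core using (¬_)
open import Relation.Unary using (Pred; _∈_; _≐_)

-- Under excluded middle, tightness makes x # y equivalent to ¬ x ≈ y, so
-- a HeytingField is a field in the classical sense; 1 ≉ 0 follows from
-- irreflexivity of # together with invertible⇒#.
fieldRing : ∀ {c ℓ₁ ℓ₂ : Level} → HeytingField c ℓ₁ ℓ₂ → CommutativeRing c ℓ₁
fieldRing F =
  HeytingCommutativeRing.commutativeRing (HeytingField.heytingCommutativeRing F)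

-- The inclusion K ⊂ L is an injective ring homomorphism ι.
record FieldExtension (k ℓk ak l ℓl al : Level)
       : Set (lsuc (k ⊔ ℓk ⊔ ak ⊔ l ⊔ ℓl ⊔ al)) where
  field
    baseField : HeytingField k ℓk ak
    topField  : HeytingField l ℓl al

  module K = CommutativeRing (fieldRing baseField)
  module L = CommutativeRing (fieldRing topField)
  open RingMorphisms K.rawRing L.rawRing using (IsRingMonomorphism)

  field
    ι                  : K.Carrier → L.Carrier
    isRingMonomorphism : IsRingMonomorphism ι

module Extension {k ℓk ak l ℓl al : Level}
                 (E : FieldExtension k ℓk ak l ℓl al) where

  open FieldExtension E public
  open RawMonoidOps L.+-rawMonoid using (sum)
  open RawMonoidOps L.*-rawMonoid using () renaming (sum to product)

  -- a₀ ∷ a₁ ∷ … ∷ [] stands for a₀ + a₁X + …; trailing zeros are allowed,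
  -- so polynomials are compared by _≈ₚ_.
  Poly : Set k
  Poly = List K.Carrier

  coeff : Poly → ℕ → K.Carrier
  coeff []      _       = K.0#
  coeff (a ∷ p) zero    = a
  coeff (a ∷ p) (suc i) = coeff p i

  infix 4 _≈ₚ_
  _≈ₚ_ : Poly → Poly → Set ℓk
  p ≈ₚ q = ∀ i → coeff p i K.≈ coeff q i

  1ₚ : Poly
  1ₚ = K.1# ∷ []

  infixl 6 _+ₚ_
  _+ₚ_ : Poly → Poly → Poly
  []      +ₚ q       = q
  (a ∷ p) +ₚ []      = a ∷ p
  (a ∷ p) +ₚ (b ∷ q) = (a K.+ b) ∷ (p +ₚ q)

  -- (a + Xp)q = aq + X(pq)
  infixl 7 _*ₚ_
  _*ₚ_ : Poly → Poly → Poly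
  []      *ₚ q = []
  (a ∷ p) *ₚ q = map (a K.*_) q +ₚ (K.0# ∷ (p *ₚ q))

  -- (a + Xp)′ = p + Xp′
  derivative : Poly → Poly
  derivative []      = []
  derivative (a ∷ p) = p +ₚ (K.0# ∷ derivative p)

  eval : Poly → L.Carrier → L.Carrier
  eval p α = foldr (λ a r → ι a L.+ α L.* r) L.0# p

  MonicOfDegree : ℕ → Poly → Set ℓk
  MonicOfDegree d p = (coeff p d K.≈ K.1#) × (∀ i → d < i → coeff p i K.≈ K.0#)

  Algebraic : L.Carrier → Set (k ⊔ ℓk ⊔ ℓl)
  Algebraic α = ∃[ p ] (¬ (p ≈ₚ []) × eval p α L.≈ L.0#)

  IsMinimalPolynomial : L.Carrier → Poly → Set (k ⊔ ℓk ⊔ ℓl)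
  IsMinimalPolynomial α p =
    ∃[ d ] ( MonicOfDegree d p
           × eval p α L.≈ L.0#
           × (∀ e q → MonicOfDegree e q → eval q α L.≈ L.0# → d ≤ e))

  Coprimeₚ : Poly → Poly → Set (k ⊔ ℓk)
  Coprimeₚ p q = ∃[ u ] ∃[ v ] (u *ₚ p +ₚ v *ₚ q ≈ₚ 1ₚ)

  Separable : L.Carrier → Set (k ⊔ ℓk ⊔ ℓl)
  Separable α = ∃[ p ] (IsMinimalPolynomial α p × Coprimeₚ p (derivative p))

  lincomb : ∀ {n} → (Fin n → K.Carrier) → (Fin n → L.Carrier) → L.Carrier
  lincomb c v = sum (λ i → ι (c i) L.* v i)

  record IsSubspace {p} (V : Pred L.Carrier p) : Set (k ⊔ l ⊔ ℓl ⊔ p) where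
    field
      resp : ∀ {x y} → x L.≈ y → x ∈ V → y ∈ V
      0∈   : L.0# ∈ V
      +∈   : ∀ {x y} → x ∈ V → y ∈ V → (x L.+ y) ∈ V
      *∈   : ∀ c {x} → x ∈ V → (ι c L.* x) ∈ V

  Span : ∀ {p} → Pred L.Carrier p → Pred L.Carrier (k ⊔ l ⊔ ℓl ⊔ p)
  Span S x = ∃[ n ] ∃[ c ] ∃[ s ] ((∀ (i : Fin n) → s i ∈ S) × x L.≈ lincomb c s)

  LinearlyIndependent : ∀ {n} → (Fin n → L.Carrier) → Set (k ⊔ ℓk ⊔ ℓl)
  LinearlyIndependent v = ∀ c → lincomb c v L.≈ L.0# → ∀ i → c i K.≈ K.0#

  record HasDim {p} (V : Pred L.Carrier p) (d : ℕ)
         : Set (k ⊔ ℓk ⊔ l ⊔ ℓl ⊔ p) where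
    field
      basis       : Fin d → L.Carrier
      basis∈      : ∀ i → basis i ∈ V
      independent : LinearlyIndependent basis
      spanning    : ∀ {x} → x ∈ V → ∃[ c ] (x L.≈ lincomb c basis)

  -- The set of products b₁⋯b_m. For m = 0 the empty product gives {1}.
  infixr 8 _^_
  _^_ : ∀ {p} → Pred L.Carrier p → ℕ → Pred L.Carrier (l ⊔ ℓl ⊔ p)
  (B ^ m) x = ∃[ b ] ((∀ (i : Fin m) → b i ∈ B) × x L.≈ product b)

  -- Hence the convention ⟨B⁰⟩ = K holds.
  span-^0 : ∀ {p} (B : Pred L.Carrier p) →
            Span (B ^ 0) ≐ (λ x → ∃[ a ] (x L.≈ ι a))
  span-^0 B = to , from
    where
    open RingMorphisms.IsRingMonomorphism isRingMonomorphism
      using (+-homo; 0#-homo)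
    sumK : ∀ {n} → (Fin n → K.Carrier) → K.Carrier
    sumK = RawMonoidOps.sum K.+-rawMonoid

    lincomb-1 : ∀ {n} (c : Fin n → K.Carrier) (s : Fin n → L.Carrier) →
                (∀ i → s i ∈ (B ^ 0)) → lincomb c s L.≈ ι (sumK c)
    lincomb-1 {zero}  c s h = L.sym 0#-homo
    lincomb-1 {suc n} c s h with h zero
    ... | _ , _ , s₀≈1 =
      L.trans (L.+-cong (L.trans (L.*-congˡ s₀≈1) (L.*-identityʳ _))
                        (lincomb-1 (c ∘ suc) (s ∘ suc) (h ∘ suc)))
              (L.sym (+-homo _ _))

    to : ∀ {x} → x ∈ Span (B ^ 0) → ∃[ a ] (x L.≈ ι a)
    to (_ , c , s , h , x≈) = sumK c , L.trans x≈ (lincomb-1 c s h)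

    from : ∀ {x} → ∃[ a ] (x L.≈ ι a) → x ∈ Span (B ^ 0)
    from (a , x≈) =
      1 , (λ _ → a) , (λ _ → L.1#) , (λ _ → (λ ()) , (λ ()) , L.refl) ,
      L.trans x≈ (L.sym (L.trans (L.+-identityʳ _) (L.*-identityʳ _)))

{-# OPTIONS --safe #-}

-- Let U be the union of the ⟨Bʲ⟩, and among the nonzero finite-dimensional
-- X ⊂ U with XB ≠ U minimise first κ = dim XB − dim X and then dim X, by A say.
-- Since X ↦ dim XB − dim X is submodular, for b ∈ B either bA = A or
-- A ∩ bA = 0; when U is finite-dimensional, A + bA might fill up U after
-- multiplication by B, which is excluded by comparing A with the annihilator
-- of AB for a nondegenerate form on U.  As bA = A for all b ≠ 0 would force
-- A = U, some bA meets A trivially, so dim AB ≥ 2 dim A, that is κ ≥ dim A,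
-- and dim B ≤ dim AB = κ + dim A ≤ 2κ.  If ⟨Bⁿ⁺¹⟩ ≠ U, the two steps from
-- ⟨Bⁿ⁻¹⟩ to ⟨Bⁿ⁺¹⟩ gain at least κ each.  If ⟨Bⁿ⁺¹⟩ = U ≠ ⟨Bⁿ⟩, then B and
-- ⟨Bⁿ⁻¹⟩ are orthogonal for a form on U that vanishes on ⟨Bⁿ⟩.
module Submission where

open import Defs
open import Level using (Level; _⊔_)
open import Axiom.ExcludedMiddle using (ExcludedMiddle)
open import Algebra.Apartness.Bundles using (HeytingField)
import Algebra.Apartness.Properties.HeytingCommutativeRing as HCRProperties
open import Algebra.Bundles using (CommutativeMonoid; CommutativeRing)
open import Algebra.Morphism.Structures using (module RingMorphisms)
import Algebra.Properties.CommutativeSemigroup as CommutativeSemigroupProperties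
import Algebra.Properties.Ring as RingProperties
import Algebra.Properties.Semiring.Sum as SumProperties
open import Data.Empty using (⊥; ⊥-elim)
open import Data.Fin.Base using (Fin; zero; suc; punchIn; punchOut; _↑ˡ_; _↑ʳ_; splitAt; join)
open import Data.Fin.Properties using (any?; _≟_; punchIn-punchOut; join-splitAt)
open import Data.Nat.Base as ℕ using (ℕ; zero; suc; _≤_; _<_; z≤n; s≤s; s<s⁻¹)
open import Data.Nat.Induction using (<-rec)
import Data.Nat.Properties as ℕ
open import Data.Product.Base using (∃-syntax; Σ-syntax; _×_; _,_; proj₁; proj₂)
open import Data.Sum.Base using (_⊎_; inj₁; inj₂)
open import Data.Vec.Functional using (_∷_; _++_)
open import Data.Vec.Functional.Properties using (lookup-++ˡ; lookup-++ʳ)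
open import Function.Base using (_∘_)
import Relation.Binary.Reasoning.Setoid as SetoidReasoning
open import Relation.Binary.PropositionalEquality as ≡ using (_≡_)
open import Relation.Nullary using (¬_; Dec; yes; no; contradiction)
open import Relation.Nullary.Decidable using (¬?; decidable-stable)
open import Relation.Unary using (Pred; _∈_; _≐_; _⊆_; _∩_)

-- Homogeneous linear systems over a field.

module ClassicalField (em : ∀ {ℓ} → ExcludedMiddle ℓ)
                      {f ℓ₁ ℓ₂} (F : HeytingField f ℓ₁ ℓ₂) where

  open HeytingField F using (tight; #⇒invertible; heytingCommutativeRing)
  open CommutativeRing (fieldRing F) hiding (zero)
  open HCRProperties heytingCommutativeRing using (x-0≈x; 1#0)
  open CommutativeSemigroupProperties *-commutativeSemigroup using (x∙yz≈y∙xz)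
  open RingProperties ring using (-‿distribˡ-*; -‿distribʳ-*)
  open SumProperties semiring
    using (sum; sum-syntax; sum-cong-≋; ∑-distrib-+; *-distribˡ-sum; sum-replicate-zero)

  1≉0 : ¬ 1# ≈ 0#
  1≉0 1≈0 = proj₂ (tight 1# 0#) 1≈0 1#0

  inverse : ∀ {x} → ¬ x ≈ 0# → ∃[ y ] y * x ≈ 1#
  inverse {x} x≉0
    with y , y[x-0]≈1 , _ ← #⇒invertible (decidable-stable em (x≉0 ∘ proj₁ (tight x 0#)))
    = y , trans (*-congˡ (sym (x-0≈x x))) y[x-0]≈1

  *-cancelˡ-0 : ∀ {x y} → ¬ x ≈ 0# → x * y ≈ 0# → y ≈ 0#
  *-cancelˡ-0 {x} {y} x≉0 xy≈0 with x⁻¹ , x⁻¹x≈1 ← inverse x≉0 = begin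
    y              ≈⟨ *-identityˡ y ⟨
    1# * y         ≈⟨ *-congʳ x⁻¹x≈1 ⟨
    x⁻¹ * x * y    ≈⟨ *-assoc x⁻¹ x y ⟩
    x⁻¹ * (x * y)  ≈⟨ *-congˡ xy≈0 ⟩
    x⁻¹ * 0#       ≈⟨ zeroʳ x⁻¹ ⟩
    0#             ∎
    where open SetoidReasoning setoid

  sum-0 : ∀ {n} (t : Fin n → Carrier) → (∀ i → t i ≈ 0#) → sum t ≈ 0#
  sum-0 {n} t t≈0 = trans (sum-cong-≋ t≈0) (sum-replicate-zero n)

  -- Gaussian elimination. If the first column vanishes, the first unit vector is a solution;
  -- otherwise a pivot in that column removes one row and one unknown, and the induction continues
  -- on the smaller system.
  underdetermined : ∀ {r d} (M : Fin r → Fin d → Carrier) → r < d →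
    Σ[ c ∈ (Fin d → Carrier) ] (¬ (∀ j → c j ≈ 0#) × ∀ i → ∑[ j < d ] (M i j * c j) ≈ 0#)
  underdetermined {r} {suc d} M r<d with any? (λ i → ¬? (em {P = M i zero ≈ 0#}))
  ... | no  column≈0 = c , (λ c≈0 → 1≉0 (c≈0 zero)) , λ i → begin
          M i zero * 1# + ∑[ j < d ] (M i (suc j) * 0#)
            ≈⟨ +-cong (trans (*-identityʳ _) (decidable-stable em λ Mi≉0 → column≈0 (i , Mi≉0)))
                      (sum-0 (λ j → M i (suc j) * 0#) (λ j → zeroʳ (M i (suc j)))) ⟩
          0# + 0#  ≈⟨ +-identityˡ 0# ⟩
          0#       ∎
    where
    open SetoidReasoning setoid
    c : Fin (suc d) → Carrier
    c zero    = 1#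
    c (suc _) = 0#
  underdetermined {suc r} {suc d} M r<d | yes (i , a≉0)
    with c′ , c′≉0 , solves ← underdetermined
           -- Rows are cleared by cross-multiplication with the pivot row, so the new entries are 2
           -- by 2 minors and no division occurs.
           (λ p k → M i zero * M (punchIn i p) (suc k) - M (punchIn i p) zero * M i (suc k))
           (s<s⁻¹ r<d)
    = c , (λ c≈0 → c′≉0 (λ k → *-cancelˡ-0 a≉0 (c≈0 (suc k)))) , row
    where
    open SetoidReasoning setoid
    a : Carrier
    a = M i zero
    s : Fin (suc r) → Carrier
    s p = ∑[ k < d ] (M p (suc k) * c′ k)
    c : Fin (suc d) → Carrier
    -- Back-substitution scaled by the pivot `a`: the pivot row becomes `a * - s i + a * s i`, and
    -- the scaled tail stays nonzero because `a` is.
    c zero    = - s i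
    c (suc k) = a * c′ k
    expand : ∀ p → ∑[ j < suc d ] (M p j * c j) ≈ M p zero * - s i + a * s p
    expand p = +-congˡ (trans
      (sum-cong-≋ {d} (λ k → x∙yz≈y∙xz (M p (suc k)) a (c′ k)))
      (sym (*-distribˡ-sum a (λ k → M p (suc k) * c′ k))))
    reduced : ∀ p k → (a * M p (suc k) - M p zero * M i (suc k)) * c′ k
                    ≈ - M p zero * (M i (suc k) * c′ k) + a * (M p (suc k) * c′ k)
    reduced p k = begin
      (a * M p (suc k) - M p zero * M i (suc k)) * c′ k
        ≈⟨ distribʳ _ _ _ ⟩
      a * M p (suc k) * c′ k + - (M p zero * M i (suc k)) * c′ k
        ≈⟨ +-comm _ _ ⟩
      - (M p zero * M i (suc k)) * c′ k + a * M p (suc k) * c′ k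
        ≈⟨ +-cong (trans (*-congʳ (-‿distribˡ-* _ _)) (*-assoc _ _ _)) (*-assoc _ _ _) ⟩
      - M p zero * (M i (suc k) * c′ k) + a * (M p (suc k) * c′ k) ∎
    row : ∀ p → ∑[ j < suc d ] (M p j * c j) ≈ 0#
    row p with i ≟ p
    ... | yes ≡.refl = begin
            ∑[ j < suc d ] (M i j * c j)  ≈⟨ expand i ⟩
            a * - s i + a * s i      ≈⟨ distribˡ a (- s i) (s i) ⟨
            a * (- s i + s i)        ≈⟨ *-congˡ (-‿inverseˡ (s i)) ⟩
            a * 0#                   ≈⟨ zeroʳ a ⟩
            0#                       ∎
    ... | no i≢p = begin
            ∑[ j < suc d ] (M p j * c j)  ≈⟨ expand p ⟩
            M p zero * - s i + a * s p
              ≈⟨ +-congʳ (trans (sym (-‿distribʳ-* _ _)) (-‿distribˡ-* _ _)) ⟩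
            - M p zero * s i + a * s p
              ≈⟨ +-cong (*-distribˡ-sum (- M p zero) (λ k → M i (suc k) * c′ k))
                        (*-distribˡ-sum a (λ k → M p (suc k) * c′ k)) ⟩
            ∑[ k < d ] (- M p zero * (M i (suc k) * c′ k)) + ∑[ k < d ] (a * (M p (suc k) * c′ k))
              ≈⟨ ∑-distrib-+ (λ k → - M p zero * (M i (suc k) * c′ k))
                             (λ k → a * (M p (suc k) * c′ k)) ⟨
            ∑[ k < d ] (- M p zero * (M i (suc k) * c′ k) + a * (M p (suc k) * c′ k))
              ≈⟨ sum-cong-≋ {d} (reduced p) ⟨
            ∑[ k < d ] ((a * M p (suc k) - M p zero * M i (suc k)) * c′ k)
              ≈⟨ ≡.subst (λ q → ∑[ k < d ] ((a * M q (suc k) - M q zero * M i (suc k)) * c′ k) ≈ 0#)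
                         (punchIn-punchOut i≢p) (solves (punchOut i≢p)) ⟩
            0# ∎

-- Extremal natural numbers.

module Extremal (em : ∀ {ℓ} → ExcludedMiddle ℓ) {ℓ} (P : ℕ → Set ℓ) where

  abstract

    -- What is found is a place where `P` stops, not necessarily the largest number satisfying it.
    -- If `P` never stopped, climbing from 0 would pass the bound.
    maximum : P 0 → ∀ n → (∀ d → P d → d ≤ n) → ∃[ d ] (P d × ¬ P (suc d))
    maximum P0 n bound = decidable-stable em λ none →
      ℕ.<-irrefl ≡.refl (bound (suc n) (climb none (suc n)))
      where
      climb : ¬ (∃[ d ] (P d × ¬ P (suc d))) → ∀ d → P d
      climb none zero    = P0
      climb none (suc d) = decidable-stable em λ ¬P → none (d , climb none d , ¬P)

    minimum : ∀ n → P n → ∃[ d ] (P d × (∀ m → P m → d ≤ m))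
    minimum = <-rec (λ n → P n → ∃[ d ] (P d × (∀ m → P m → d ≤ m))) λ n below Pn →
      case-below n below Pn em
      where
      case-below : ∀ n → (∀ {m} → m < n → P m → ∃[ d ] (P d × (∀ m → P m → d ≤ m))) →
                   P n → Dec (∃[ m ] (m < n × P m)) → ∃[ d ] (P d × (∀ m → P m → d ≤ m))
      case-below n below Pn (yes (m , m<n , Pm)) = below m<n Pm
      case-below n below Pn (no  none) = n , Pn , λ m Pm → ℕ.≮⇒≥ (λ m<n → none (m , m<n , Pm))

-- Linear combinations over `K` in `L`.

module LinearAlgebra (em : ∀ {ℓ} → ExcludedMiddle ℓ)
                     {k ℓk ak l ℓl al : Level} (E : FieldExtension k ℓk ak l ℓl al) where

  open Extension E
  open RingMorphisms.IsRingMonomorphism isRingMonomorphism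
    using (+-homo; *-homo; 0#-homo; 1#-homo; -‿homo; ⟦⟧-cong)
  open SumProperties L.semiring
    using (sum; sum-syntax; sum-cong-≋; ∑-distrib-+; ∑-comm; *-distribˡ-sum; *-distribʳ-sum)
  open CommutativeSemigroupProperties L.*-commutativeSemigroup using (x∙yz≈y∙xz)
  open CommutativeSemigroupProperties
    (CommutativeMonoid.commutativeSemigroup L.+-commutativeMonoid) using (interchange)
  module ∑K = SumProperties K.semiring
  module KF = ClassicalField em baseField
  module LF = ClassicalField em topField
  open SetoidReasoning L.setoid

  private variable
    p q r : Level
    a b d m n : ℕ
    V W X Y : Pred L.Carrier p

  abstract

    ι-sum : (t : Fin n → K.Carrier) → ι (∑K.sum t) L.≈ ∑[ i < n ] ι (t i)
    ι-sum {zero}  t = 0#-homo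
    ι-sum {suc n} t = L.trans (+-homo _ _) (L.+-congˡ (ι-sum (t ∘ suc)))

    lincomb-cong : ∀ {n} {c c′ : Fin n → K.Carrier} {v v′ : Fin n → L.Carrier} →
                   (∀ i → c i K.≈ c′ i) → (∀ i → v i L.≈ v′ i) → lincomb c v L.≈ lincomb c′ v′
    lincomb-cong {n} c≈ v≈ = sum-cong-≋ {n} (λ i → L.*-cong (⟦⟧-cong (c≈ i)) (v≈ i))

    lincomb-0 : (c : Fin n → K.Carrier) (v : Fin n → L.Carrier) →
                (∀ i → c i K.≈ K.0#) → lincomb c v L.≈ L.0#
    lincomb-0 c v c≈0 = LF.sum-0 _ λ i →
      L.trans (L.*-congʳ (L.trans (⟦⟧-cong (c≈0 i)) 0#-homo)) (L.zeroˡ _)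

    lincomb-+ : (c c′ : Fin n → K.Carrier) (v : Fin n → L.Carrier) →
                lincomb (λ i → c i K.+ c′ i) v L.≈ lincomb c v L.+ lincomb c′ v
    lincomb-+ {n} c c′ v = L.trans
      (sum-cong-≋ {n} (λ i → L.trans (L.*-congʳ (+-homo _ _)) (L.distribʳ _ _ _)))
      (∑-distrib-+ (λ i → ι (c i) L.* v i) (λ i → ι (c′ i) L.* v i))

    lincomb-*ˡ : ∀ s (c : Fin n → K.Carrier) (v : Fin n → L.Carrier) →
                 lincomb (λ i → s K.* c i) v L.≈ ι s L.* lincomb c v
    lincomb-*ˡ {n} s c v = L.trans
      (sum-cong-≋ {n} (λ i → L.trans (L.*-congʳ (*-homo _ _)) (L.*-assoc _ _ _)))
      (L.sym (*-distribˡ-sum (ι s) (λ i → ι (c i) L.* v i)))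

    lincomb-*ʳ : ∀ (c : Fin n → K.Carrier) (v : Fin n → L.Carrier) x →
                 lincomb c v L.* x L.≈ lincomb c (λ i → v i L.* x)
    lincomb-*ʳ {n} c v x = L.trans (*-distribʳ-sum x (λ i → ι (c i) L.* v i))
      (sum-cong-≋ {n} (λ i → L.*-assoc _ _ _))

    lincomb-scale : ∀ x (c : Fin n → K.Carrier) (v : Fin n → L.Carrier) →
                    lincomb c (λ i → x L.* v i) L.≈ x L.* lincomb c v
    lincomb-scale x c v = L.trans (lincomb-cong (λ _ → K.refl) (λ i → L.*-comm x (v i)))
      (L.trans (L.sym (lincomb-*ʳ c v x)) (L.*-comm _ x))

    lincomb-lincomb : (c : Fin d → K.Carrier) (M : Fin n → Fin d → K.Carrier) (v : Fin n → L.Carrier) →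
      lincomb c (λ j → lincomb (λ i → M i j) v) L.≈ lincomb (λ i → ∑K.sum (λ j → M i j K.* c j)) v
    lincomb-lincomb {d} {n} c M v = begin
      ∑[ j < d ] (ι (c j) L.* ∑[ i < n ] (ι (M i j) L.* v i))
        ≈⟨ sum-cong-≋ {d} (λ j → *-distribˡ-sum (ι (c j)) (λ i → ι (M i j) L.* v i)) ⟩
      ∑[ j < d ] ∑[ i < n ] (ι (c j) L.* (ι (M i j) L.* v i))
        ≈⟨ ∑-comm (λ j i → ι (c j) L.* (ι (M i j) L.* v i)) ⟩
      ∑[ i < n ] ∑[ j < d ] (ι (c j) L.* (ι (M i j) L.* v i))
        ≈⟨ sum-cong-≋ {n} (λ i → sum-cong-≋ {d} (λ j →
             L.trans (L.sym (L.*-assoc _ _ _))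
                     (L.*-congʳ (L.trans (L.*-comm _ _) (L.sym (*-homo _ _)))))) ⟩
      ∑[ i < n ] ∑[ j < d ] (ι (M i j K.* c j) L.* v i)
        ≈⟨ sum-cong-≋ {n} (λ i → L.trans (L.*-congʳ (ι-sum (λ j → M i j K.* c j)))
                                         (*-distribʳ-sum (v i) (λ j → ι (M i j K.* c j)))) ⟨
      ∑[ i < n ] (ι (∑K.sum (λ j → M i j K.* c j)) L.* v i) ∎

    sum-split : ∀ a (t : Fin (a ℕ.+ b) → L.Carrier) →
                sum t L.≈ ∑[ i < a ] t (i ↑ˡ b) L.+ ∑[ i < b ] t (a ↑ʳ i)
    sum-split zero    t = L.sym (L.+-identityˡ _)
    sum-split (suc a) t = L.trans (L.+-congˡ (sum-split a (t ∘ suc))) (L.sym (L.+-assoc _ _ _))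

    lincomb-split : (c : Fin (a ℕ.+ b) → K.Carrier) (v : Fin a → L.Carrier) (w : Fin b → L.Carrier) →
      lincomb c (v ++ w) L.≈ lincomb (λ i → c (i ↑ˡ b)) v L.+ lincomb (λ i → c (a ↑ʳ i)) w
    lincomb-split {a} {b} c v w = L.trans (sum-split a (λ i → ι (c i) L.* (v ++ w) i)) (L.+-cong
      (sum-cong-≋ {a} (λ i → L.*-congˡ (L.reflexive (lookup-++ˡ v w i))))
      (sum-cong-≋ {b} (λ i → L.*-congˡ (L.reflexive (lookup-++ʳ v w i)))))

    lincomb-++ : (c : Fin a → K.Carrier) (c′ : Fin b → K.Carrier)
                 (v : Fin a → L.Carrier) (w : Fin b → L.Carrier) →
                 lincomb (c ++ c′) (v ++ w) L.≈ lincomb c v L.+ lincomb c′ w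
    lincomb-++ c c′ v w = L.trans (lincomb-split (c ++ c′) v w) (L.+-cong
      (lincomb-cong (λ i → K.reflexive (lookup-++ˡ c c′ i)) (λ _ → L.refl))
      (lincomb-cong (λ i → K.reflexive (lookup-++ʳ c c′ i)) (λ _ → L.refl)))

    ++-∈ : ∀ (v : Fin a → L.Carrier) (w : Fin b → L.Carrier) →
           (∀ i → v i ∈ V) → (∀ i → w i ∈ V) → ∀ i → (v ++ w) i ∈ V
    ++-∈ {a} v w v∈ w∈ i with splitAt a i
    ... | inj₁ j = v∈ j
    ... | inj₂ j = w∈ j

  -- Closure properties of subspaces.

  module _ (V-sub : IsSubspace V) where
    open IsSubspace V-sub

    neg∈ : ∀ {x} → x ∈ V → L.- x ∈ V
    neg∈ {x} x∈V = resp
      (L.trans (L.*-congʳ (L.trans (-‿homo K.1#) (L.-‿cong 1#-homo))) (-1*x≈-x x))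
      (*∈ (K.- K.1#) x∈V)
      where open RingProperties L.ring using (-1*x≈-x)

    cancel∈ : ∀ {x y} → x ∈ V → x L.+ y ∈ V → y ∈ V
    cancel∈ {x} {y} x∈V x+y∈V = resp
      (L.trans (L.sym (L.+-assoc _ _ _)) (L.trans (L.+-congʳ (L.-‿inverseˡ x)) (L.+-identityˡ y)))
      (+∈ (neg∈ x∈V) x+y∈V)

    sum∈ : (t : Fin n → L.Carrier) → (∀ i → t i ∈ V) → sum t ∈ V
    sum∈ {zero}  t t∈V = 0∈
    sum∈ {suc n} t t∈V = +∈ (t∈V zero) (sum∈ (t ∘ suc) (t∈V ∘ suc))

    lincomb∈ : (c : Fin n → K.Carrier) (v : Fin n → L.Carrier) → (∀ i → v i ∈ V) → lincomb c v ∈ V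
    lincomb∈ c v v∈V = sum∈ _ (λ i → *∈ (c i) (v∈V i))

  𝟎 : Pred L.Carrier ℓl
  𝟎 x = x L.≈ L.0#

  abstract

    𝟎-sub : IsSubspace 𝟎
    𝟎-sub = record
      { resp = λ x≈y x≈0 → L.trans (L.sym x≈y) x≈0
      ; 0∈   = L.refl
      ; +∈   = λ x≈0 y≈0 → L.trans (L.+-cong x≈0 y≈0) (L.+-identityˡ _)
      ; *∈   = λ c x≈0 → L.trans (L.*-congˡ x≈0) (L.zeroʳ _)
      }

  -- Relative bases and dimension.

  infixl 6 _⊞_ _⊕_
  _⊞_ : Pred L.Carrier p → (Fin n → L.Carrier) → Pred L.Carrier (p ⊔ k ⊔ l ⊔ ℓl)
  (V ⊞ w) x = ∃[ v ] ∃[ c ] (v ∈ V × x L.≈ v L.+ lincomb c w)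

  IndependentMod : Pred L.Carrier p → (Fin n → L.Carrier) → Set (p ⊔ k ⊔ ℓk)
  IndependentMod V w = ∀ c → lincomb c w ∈ V → ∀ i → c i K.≈ K.0#

  -- Represents a basis of the quotient W / V.
  record RelativeBasis (V : Pred L.Carrier p) (W : Pred L.Carrier q) (d : ℕ)
         : Set (p ⊔ q ⊔ k ⊔ ℓk ⊔ l ⊔ ℓl) where
    field
      basis       : Fin d → L.Carrier
      basis∈      : ∀ i → basis i ∈ W
      independent : IndependentMod V basis
      spanning    : W ⊆ V ⊞ basis

  abstract

    -- Dimension is the case of a relative basis over `𝟎`: `IndependentMod 𝟎` unfolds to
    -- `LinearlyIndependent`, so only the spanning condition needs translation.
    hasDim⇒relative : HasDim W d → RelativeBasis 𝟎 W d
    hasDim⇒relative h = record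
      { basis = basis ; basis∈ = basis∈ ; independent = independent
      ; spanning = λ x∈W → let c , x≈ = spanning x∈W in
          L.0# , c , L.refl , L.trans x≈ (L.sym (L.+-identityˡ _)) }
      where open HasDim h

    relative⇒hasDim : RelativeBasis 𝟎 W d → HasDim W d
    relative⇒hasDim h = record
      { basis = basis ; basis∈ = basis∈ ; independent = independent
      ; spanning = λ x∈W → let v , c , v≈0 , x≈ = spanning x∈W in
          c , L.trans x≈ (L.trans (L.+-congʳ v≈0) (L.+-identityˡ _)) }
      where open RelativeBasis h

  -- Finite-dimensionality in a form that presupposes no basis; `hasDim` converts such a bound into
  -- a basis.
  BoundedRank : Pred L.Carrier p → ℕ → Set (p ⊔ k ⊔ ℓk ⊔ l ⊔ ℓl)
  BoundedRank W n = ∀ d (u : Fin d → L.Carrier) → (∀ i → u i ∈ W) → LinearlyIndependent u → d ≤ n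

  abstract

    -- With more than `n` vectors in `W`, their coordinate matrix has more columns than rows, and a
    -- nonzero kernel vector is a linear relation between them.
    steinitz : (v : Fin n → L.Carrier) → (∀ {x} → x ∈ W → ∃[ c ] x L.≈ lincomb c v) → BoundedRank W n
    steinitz {n} v span d u u∈W u-ind = ℕ.≮⇒≥ λ n<d →
      let M : Fin n → Fin d → K.Carrier
          M i j = proj₁ (span (u∈W j)) i
          c , c≉0 , Mc≈0 = KF.underdetermined M n<d
      in c≉0 (u-ind c (begin
        lincomb c u                                    ≈⟨ lincomb-cong (λ _ → K.refl) (λ j → proj₂ (span (u∈W j))) ⟩
        lincomb c (λ j → lincomb (λ i → M i j) v)      ≈⟨ lincomb-lincomb c M v ⟩
        lincomb (λ i → ∑K.sum (λ j → M i j K.* c j)) v ≈⟨ lincomb-0 _ v Mc≈0 ⟩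
        L.0# ∎))

    hasDim⇒bounded : HasDim W n → BoundedRank W n
    hasDim⇒bounded h = steinitz (HasDim.basis h) (HasDim.spanning h)

    -- A family in `W` that is independent modulo `V` is in particular independent, so its length is
    -- bounded; a family that cannot be lengthened must span.
    relativeBasis : IsSubspace V → BoundedRank W n → ∃[ d ] RelativeBasis V W d
    relativeBasis {V = V} {W = W} {n = n} V-sub bound
      with d , (u , u∈W , u-ind) , maximal ← Extremal.maximum em
             (λ d → Σ[ u ∈ (Fin d → L.Carrier) ] ((∀ i → u i ∈ W) × IndependentMod V u))
             ((λ ()) , (λ ()) , λ _ _ ()) n
             (λ d (u , u∈W , u-ind) → bound d u u∈W (λ c cu≈0 →
               u-ind c (IsSubspace.resp V-sub (L.sym cu≈0) (IsSubspace.0∈ V-sub))))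
      = d , record { basis = u ; basis∈ = u∈W ; independent = u-ind ; spanning = span }
      where
      open IsSubspace V-sub
      open RingProperties L.ring using (-‿distribˡ-*)
      span : W ⊆ V ⊞ u
      span {x} x∈W = decidable-stable em λ x∉ → maximal
        (x ∷ u , (λ { zero → x∈W ; (suc i) → u∈W i }) , extended x∉)
        where
        extended : ¬ x ∈ V ⊞ u → IndependentMod V (x ∷ u)
        extended x∉ c cxu∈V = λ { zero → c₀≈0 ; (suc i) → u-ind (c ∘ suc) cu∈V i }
          where
          S : L.Carrier
          S = lincomb (c ∘ suc) u
          c₀≈0 : c zero K.≈ K.0#
          -- A nonzero `c zero` could be inverted: with `s` its inverse, `x` is `s` times the given
          -- element of `V` minus `s` times `S`, which puts `x` in `V ⊞ u`.
          c₀≈0 = decidable-stable em λ c₀≉0 →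
            let s , sc₀≈1 = KF.inverse c₀≉0 in
            x∉ (ι s L.* (ι (c zero) L.* x L.+ S) , (λ i → K.- s K.* c (suc i)) , *∈ s cxu∈V , (begin
              x ≈⟨ L.*-identityˡ x ⟨
              L.1# L.* x ≈⟨ L.*-congʳ (L.trans (⟦⟧-cong sc₀≈1) 1#-homo) ⟨
              ι (s K.* c zero) L.* x
                ≈⟨ L.trans (L.*-congʳ (*-homo _ _)) (L.*-assoc _ _ _) ⟩
              ι s L.* (ι (c zero) L.* x) ≈⟨ L.+-identityʳ _ ⟨
              ι s L.* (ι (c zero) L.* x) L.+ L.0#
                ≈⟨ L.+-congˡ (L.-‿inverseʳ (ι s L.* S)) ⟨
              ι s L.* (ι (c zero) L.* x) L.+ (ι s L.* S L.- ι s L.* S)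
                ≈⟨ L.+-assoc _ _ _ ⟨
              ι s L.* (ι (c zero) L.* x) L.+ ι s L.* S L.- ι s L.* S
                ≈⟨ L.+-cong (L.distribˡ _ _ _)
                     (L.trans (L.*-congʳ (-‿homo s)) (L.sym (-‿distribˡ-* (ι s) S))) ⟨
              ι s L.* (ι (c zero) L.* x L.+ S) L.+ ι (K.- s) L.* S
                ≈⟨ L.+-congˡ (lincomb-*ˡ (K.- s) (c ∘ suc) u) ⟨
              ι s L.* (ι (c zero) L.* x L.+ S) L.+ lincomb (λ i → K.- s K.* c (suc i)) u ∎))
          cu∈V : S ∈ V
          cu∈V = resp (L.trans (L.+-congʳ (L.trans (L.*-congʳ (L.trans (⟦⟧-cong c₀≈0) 0#-homo)) (L.zeroˡ x)))
                               (L.+-identityˡ S)) cxu∈V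

    hasDim : BoundedRank W n → ∃[ d ] HasDim W d
    hasDim bound = let d , h = relativeBasis 𝟎-sub bound in d , relative⇒hasDim h

    -- Dimensions of quotients add along a chain. In a relation modulo `U`, the part from `F` lies
    -- in `V`, so the coefficients of `G` vanish first; what remains is a relation for `F` modulo
    -- `U`.
    relative-trans : ∀ {U : Pred L.Carrier r} → IsSubspace U → IsSubspace V → U ⊆ V → V ⊆ W →
      RelativeBasis U V a → RelativeBasis V W b → RelativeBasis U W (a ℕ.+ b)
    relative-trans {V = V} {W = W} {a = a} {b = b} {U = U} U-sub V-sub U⊆V V⊆W f g = record
      { basis       = F.basis ++ G.basis
      ; basis∈      = ++-∈ {V = W} F.basis G.basis (V⊆W ∘ F.basis∈) G.basis∈
      ; independent = ind
      ; spanning    = span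
      }
      where
      module F = RelativeBasis f
      module G = RelativeBasis g
      open IsSubspace V-sub
      ind : IndependentMod U (F.basis ++ G.basis)
      ind c c∈U = λ i → ≡.subst (λ j → c j K.≈ K.0#) (join-splitAt a b i) (both (splitAt a i))
        where
        c₁ : Fin a → K.Carrier
        c₁ i = c (i ↑ˡ b)
        c₂ : Fin b → K.Carrier
        c₂ i = c (a ↑ʳ i)
        c₂≈0 : ∀ i → c₂ i K.≈ K.0#
        c₂≈0 = G.independent c₂ (cancel∈ V-sub (lincomb∈ V-sub c₁ F.basis F.basis∈)
          (resp (lincomb-split c F.basis G.basis) (U⊆V c∈U)))
        c₁≈0 : ∀ i → c₁ i K.≈ K.0#
        c₁≈0 = F.independent c₁ (IsSubspace.resp U-sub (begin
          lincomb c (F.basis ++ G.basis)             ≈⟨ lincomb-split c F.basis G.basis ⟩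
          lincomb c₁ F.basis L.+ lincomb c₂ G.basis  ≈⟨ L.+-congˡ (lincomb-0 c₂ G.basis c₂≈0) ⟩
          lincomb c₁ F.basis L.+ L.0#                ≈⟨ L.+-identityʳ _ ⟩
          lincomb c₁ F.basis                         ∎) c∈U)
        both : (s : Fin a ⊎ Fin b) → c (join a b s) K.≈ K.0#
        both (inj₁ i) = c₁≈0 i
        both (inj₂ i) = c₂≈0 i
      span : W ⊆ U ⊞ (F.basis ++ G.basis)
      span x∈W with v , c₂ , v∈V , x≈ ← G.spanning x∈W
               with u , c₁ , u∈U , v≈ ← F.spanning v∈V
        = u , c₁ ++ c₂ , u∈U , L.trans x≈ (L.trans (L.+-congʳ v≈) (L.trans (L.+-assoc _ _ _)
            (L.+-congˡ (L.sym (lincomb-++ c₁ c₂ F.basis G.basis)))))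

    relative-dim : IsSubspace V → V ⊆ W → HasDim V a → RelativeBasis V W b → HasDim W (a ℕ.+ b)
    relative-dim V-sub V⊆W hV g = relative⇒hasDim (relative-trans 𝟎-sub V-sub
      (λ x≈0 → IsSubspace.resp V-sub (L.sym x≈0) (IsSubspace.0∈ V-sub)) V⊆W (hasDim⇒relative hV) g)

    dim-mono : V ⊆ W → HasDim V a → HasDim W b → a ≤ b
    dim-mono V⊆W hV hW = hasDim⇒bounded hW _ basis (V⊆W ∘ basis∈) independent
      where open HasDim hV

    dim-unique : HasDim V a → HasDim V b → a ≡ b
    dim-unique h h′ = ℕ.≤-antisym (dim-mono (λ x∈V → x∈V) h h′) (dim-mono (λ x∈V → x∈V) h′ h)

    dim-⊆ : V ⊆ W → HasDim W n → ∃[ d ] HasDim V d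
    dim-⊆ V⊆W hW = hasDim λ d u u∈V → hasDim⇒bounded hW d u (V⊆W ∘ u∈V)

    dim-≐ : V ⊆ W → W ⊆ V → HasDim V d → HasDim W d
    dim-≐ V⊆W W⊆V h = record
      { basis = basis ; basis∈ = V⊆W ∘ basis∈ ; independent = independent ; spanning = spanning ∘ W⊆V }
      where open HasDim h

    -- A relative basis with at least one element would make the dimension of `W` exceed that of
    -- `V`; an empty one says that `W` is contained in `V`.
    dim-full : IsSubspace V → V ⊆ W → HasDim V a → HasDim W b → b ≤ a → W ⊆ V
    dim-full {V = V} {W = W} {a = a} V-sub V⊆W hV hW b≤a
      with relativeBasis V-sub (hasDim⇒bounded hW)
    ... | zero  , g = λ x∈W → let v , c , v∈V , x≈ = RelativeBasis.spanning g x∈W in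
            IsSubspace.resp V-sub (L.sym (L.trans x≈ (L.+-identityʳ v))) v∈V
    ... | suc d , g = contradiction b≤a (ℕ.<⇒≱ (ℕ.<-≤-trans (ℕ.m<m+n a (s≤s z≤n))
            (dim-mono (λ x∈W → x∈W) (relative-dim V-sub V⊆W hV g) hW)))

    dim-zero : HasDim V 0 → V ⊆ 𝟎
    dim-zero h x∈V = proj₂ (HasDim.spanning h x∈V)

    trivial-dim : V ⊆ 𝟎 → HasDim V d → d ≡ 0
    trivial-dim V⊆𝟎 h = ℕ.n≤0⇒n≡0 (dim-mono V⊆𝟎 h (record
      { basis = λ () ; basis∈ = λ () ; independent = λ _ _ () ; spanning = λ x≈0 → (λ ()) , x≈0 }))

  -- Sums and intersections of subspaces.

  _⊕_ : Pred L.Carrier p → Pred L.Carrier q → Pred L.Carrier (p ⊔ q ⊔ l ⊔ ℓl)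
  (X ⊕ Y) z = ∃[ x ] ∃[ y ] (x ∈ X × y ∈ Y × z L.≈ x L.+ y)

  abstract

    Span-sub : ∀ (S : Pred L.Carrier p) → IsSubspace (Span S)
    Span-sub S = record
      { resp = λ x≈y (n , c , s , s∈S , x≈) → n , c , s , s∈S , L.trans (L.sym x≈y) x≈
      ; 0∈   = 0 , (λ ()) , (λ ()) , (λ ()) , L.refl
      ; +∈   = λ (m , c , s , s∈S , x≈) (n , c′ , s′ , s′∈S , y≈) →
                 m ℕ.+ n , c ++ c′ , s ++ s′ , ++-∈ {V = S} s s′ s∈S s′∈S ,
                 L.trans (L.+-cong x≈ y≈) (L.sym (lincomb-++ c c′ s s′))
      ; *∈   = λ a (n , c , s , s∈S , x≈) →
                 n , (λ i → a K.* c i) , s , s∈S , L.trans (L.*-congˡ x≈) (L.sym (lincomb-*ˡ a c s))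
      }

    Span-⊆ : ∀ {S : Pred L.Carrier q} → IsSubspace V → S ⊆ V → Span S ⊆ V
    Span-⊆ sV S⊆V (n , c , s , s∈S , x≈) =
      IsSubspace.resp sV (L.sym x≈) (lincomb∈ sV c s (S⊆V ∘ s∈S))

    ⊆-Span : ∀ (S : Pred L.Carrier p) → S ⊆ Span S
    ⊆-Span S {x} x∈S = 1 , (λ _ → K.1#) , (λ _ → x) , (λ _ → x∈S) , L.sym
      (L.trans (L.+-identityʳ _) (L.trans (L.*-congʳ 1#-homo) (L.*-identityˡ x)))

    nonzero : ¬ V ⊆ 𝟎 → ∃[ x ] (x ∈ V × ¬ x L.≈ L.0#)
    nonzero V⊈𝟎 = decidable-stable em λ none → V⊈𝟎 λ {x} x∈V →
      decidable-stable em λ x≉0 → none (x , x∈V , x≉0)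

    ∩-sub : IsSubspace X → IsSubspace Y → IsSubspace (X ∩ Y)
    ∩-sub sX sY = record
      { resp = λ x≈y (x∈X , x∈Y) → X.resp x≈y x∈X , Y.resp x≈y x∈Y
      ; 0∈   = X.0∈ , Y.0∈
      ; +∈   = λ (x∈X , x∈Y) (y∈X , y∈Y) → X.+∈ x∈X y∈X , Y.+∈ x∈Y y∈Y
      ; *∈   = λ c (x∈X , x∈Y) → X.*∈ c x∈X , Y.*∈ c x∈Y
      }
      where
      module X = IsSubspace sX
      module Y = IsSubspace sY

    ⊕-sub : IsSubspace X → IsSubspace Y → IsSubspace (X ⊕ Y)
    ⊕-sub sX sY = record
      { resp = λ z≈z′ (x , y , x∈X , y∈Y , z≈) → x , y , x∈X , y∈Y , L.trans (L.sym z≈z′) z≈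
      ; 0∈   = L.0# , L.0# , X.0∈ , Y.0∈ , L.sym (L.+-identityˡ _)
      ; +∈   = λ (x , y , x∈X , y∈Y , z≈) (x′ , y′ , x′∈X , y′∈Y , z′≈) →
                 x L.+ x′ , y L.+ y′ , X.+∈ x∈X x′∈X , Y.+∈ y∈Y y′∈Y ,
                 L.trans (L.+-cong z≈ z′≈) (interchange _ _ _ _)
      ; *∈   = λ c (x , y , x∈X , y∈Y , z≈) →
                 ι c L.* x , ι c L.* y , X.*∈ c x∈X , Y.*∈ c y∈Y , L.trans (L.*-congˡ z≈) (L.distribˡ _ _ _)
      }
      where
      module X = IsSubspace sX
      module Y = IsSubspace sY

    ⊕-inˡ : IsSubspace Y → X ⊆ X ⊕ Y
    ⊕-inˡ sY {x} x∈X = x , L.0# , x∈X , IsSubspace.0∈ sY , L.sym (L.+-identityʳ x)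

    ⊕-inʳ : IsSubspace X → Y ⊆ X ⊕ Y
    ⊕-inʳ sX {y} y∈Y = L.0# , y , IsSubspace.0∈ sX , y∈Y , L.sym (L.+-identityˡ y)

    ⊕-⊆ : IsSubspace W → X ⊆ W → Y ⊆ W → X ⊕ Y ⊆ W
    ⊕-⊆ sW X⊆W Y⊆W (_ , _ , x∈X , y∈Y , z≈) =
      IsSubspace.resp sW (L.sym z≈) (IsSubspace.+∈ sW (X⊆W x∈X) (Y⊆W y∈Y))

    -- The same vectors serve on both sides: a combination of them lies in `X` anyway, so it lies in
    -- `Y` exactly when it lies in `X ∩ Y`.
    second-isomorphism : IsSubspace X → IsSubspace Y →
                         RelativeBasis (X ∩ Y) X d → RelativeBasis Y (X ⊕ Y) d
    second-isomorphism sX sY g = record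
      { basis       = basis
      ; basis∈      = ⊕-inˡ sY ∘ basis∈
      ; independent = λ c cb∈Y → independent c (lincomb∈ sX c basis basis∈ , cb∈Y)
      ; spanning    = λ (x , y , x∈X , y∈Y , z≈) →
          let v , c , (_ , v∈Y) , x≈ = spanning x∈X in
          y L.+ v , c , IsSubspace.+∈ sY y∈Y v∈Y ,
          L.trans z≈ (L.trans (L.+-comm x y) (L.trans (L.+-congˡ x≈) (L.sym (L.+-assoc _ _ _))))
      }
      where open RelativeBasis g

    -- One relative basis of `X` modulo `X ∩ Y`, of length `d`, governs both sides: `a` is `i + d`
    -- and the sum has dimension `b + d`.
    grassmann : IsSubspace X → IsSubspace Y → HasDim X a → HasDim Y b →
                ∃[ i ] ∃[ s ] (HasDim (X ∩ Y) i × HasDim (X ⊕ Y) s × i ℕ.+ s ≡ a ℕ.+ b)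
    grassmann {X = X} {Y = Y} {a = a} {b = b} sX sY hX hY =
      let i , hI = dim-⊆ {V = X ∩ Y} proj₁ hX
          d , g  = relativeBasis (∩-sub sX sY) (hasDim⇒bounded hX)
      in i , b ℕ.+ d , hI ,
         relative-dim sY (⊕-inʳ sX) hY (second-isomorphism sX sY g) ,
         count i d (dim-unique (relative-dim (∩-sub sX sY) proj₁ hI g) hX)
      where
      count : ∀ i d → i ℕ.+ d ≡ a → i ℕ.+ (b ℕ.+ d) ≡ a ℕ.+ b
      count i d i+d≡a = ≡.trans (≡.cong (i ℕ.+_) (ℕ.+-comm b d))
        (≡.trans (≡.sym (ℕ.+-assoc i d b)) (≡.cong (ℕ._+ b) i+d≡a))

  -- Multiples of a subspace by an element of `L`.

  _⋆_ : L.Carrier → Pred L.Carrier p → Pred L.Carrier (p ⊔ l ⊔ ℓl)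
  (x ⋆ V) z = ∃[ v ] (v ∈ V × z L.≈ x L.* v)

  abstract

    ⋆-sub : ∀ x → IsSubspace V → IsSubspace (x ⋆ V)
    ⋆-sub x sV = record
      { resp = λ y≈z (v , v∈V , y≈) → v , v∈V , L.trans (L.sym y≈z) y≈
      ; 0∈   = L.0# , 0∈ , L.sym (L.zeroʳ x)
      ; +∈   = λ (v , v∈V , y≈) (w , w∈V , z≈) →
                 v L.+ w , +∈ v∈V w∈V , L.trans (L.+-cong y≈ z≈) (L.sym (L.distribˡ x v w))
      ; *∈   = λ c (v , v∈V , y≈) → ι c L.* v , *∈ c v∈V ,
                 L.trans (L.*-congˡ y≈) (x∙yz≈y∙xz (ι c) x v)
      }
      where open IsSubspace sV

    scaled-independent : ∀ {x} → ¬ x L.≈ L.0# → (v : Fin n → L.Carrier) →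
      LinearlyIndependent v → LinearlyIndependent (λ i → x L.* v i)
    scaled-independent {x = x} x≉0 v v-ind c cxv≈0 =
      v-ind c (LF.*-cancelˡ-0 x≉0 (L.trans (L.sym (lincomb-scale x c v)) cxv≈0))

    ⋆-dim : ∀ {x} → ¬ x L.≈ L.0# → HasDim V d → HasDim (x ⋆ V) d
    ⋆-dim {x = x} x≉0 h = record
      { basis       = λ i → x L.* basis i
      ; basis∈      = λ i → basis i , basis∈ i , L.refl
      ; independent = scaled-independent x≉0 basis independent
      ; spanning    = λ (v , v∈V , z≈) → let c , v≈ = spanning v∈V in
          c , L.trans z≈ (L.trans (L.*-congˡ v≈) (L.sym (lincomb-scale x c basis)))
      }
      where open HasDim h

    -- Multiplication by `x` embeds `U` into `V`, so the rank of `U` is at most `a`. Finite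
    -- dimension of `U` is thereby a conclusion, and equality follows by counting.
    absorb : ∀ {U : Pred L.Carrier r} {x} → IsSubspace V → V ⊆ U → HasDim V a →
             ¬ x L.≈ L.0# → (∀ {u} → u ∈ U → x L.* u ∈ V) → U ⊆ V
    absorb {a = a} {U = U} {x = x} sV V⊆U hV x≉0 xU⊆V =
      dim-full sV V⊆U hV (proj₂ hU) (bounded _ basis basis∈ independent)
      where
      bounded : BoundedRank U a
      bounded d u u∈U u-ind = hasDim⇒bounded hV d (λ i → x L.* u i) (xU⊆V ∘ u∈U)
        (scaled-independent x≉0 u u-ind)
      hU : ∃[ m ] HasDim U m
      hU = hasDim bounded
      open HasDim (proj₂ hU)

  -- Products of a subspace with the span of a finite family.

  -- For a subspace V, the span of the products of elements of V and ⟨β⟩.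
  _∙_ : Pred L.Carrier p → (Fin n → L.Carrier) → Pred L.Carrier (p ⊔ l ⊔ ℓl)
  _∙_ {n = n} V β z = Σ[ x ∈ (Fin n → L.Carrier) ] ((∀ i → x i ∈ V) × z L.≈ ∑[ i < n ] (x i L.* β i))

  abstract

    ∙-sub : ∀ (β : Fin n → L.Carrier) → IsSubspace V → IsSubspace (V ∙ β)
    ∙-sub {n = n} β sV = record
      { resp = λ y≈z (x , x∈V , y≈) → x , x∈V , L.trans (L.sym y≈z) y≈
      ; 0∈   = (λ _ → L.0#) , (λ _ → 0∈) , L.sym (LF.sum-0 (λ i → L.0# L.* β i) (λ i → L.zeroˡ (β i)))
      ; +∈   = λ (x , x∈V , z≈) (x′ , x′∈V , z′≈) →
          (λ i → x i L.+ x′ i) , (λ i → +∈ (x∈V i) (x′∈V i)) , L.trans (L.+-cong z≈ z′≈)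
          (L.sym (L.trans (sum-cong-≋ {n} (λ i → L.distribʳ (β i) (x i) (x′ i)))
                          (∑-distrib-+ (λ i → x i L.* β i) (λ i → x′ i L.* β i))))
      ; *∈   = λ c (x , x∈V , z≈) →
          (λ i → ι c L.* x i) , (λ i → *∈ c (x∈V i)) , L.trans (L.*-congˡ z≈)
          (L.trans (*-distribˡ-sum (ι c) (λ i → x i L.* β i))
                   (sum-cong-≋ {n} (λ i → L.sym (L.*-assoc (ι c) (x i) (β i)))))
      }
      where open IsSubspace sV

    ∙-⊆ : ∀ (β : Fin n → L.Carrier) → IsSubspace W → (∀ {x} i → x ∈ V → x L.* β i ∈ W) → V ∙ β ⊆ W
    ∙-⊆ β sW Vβ⊆W (x , x∈V , z≈) = IsSubspace.resp sW (L.sym z≈)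
      (sum∈ sW (λ i → x i L.* β i) (λ i → Vβ⊆W i (x∈V i)))

    ∙-mono : ∀ (β : Fin n → L.Carrier) → V ⊆ W → V ∙ β ⊆ W ∙ β
    ∙-mono β V⊆W (x , x∈V , z≈) = x , (λ i → V⊆W (x∈V i)) , z≈

    *∈∙ : ∀ (β : Fin n → L.Carrier) → IsSubspace V → ∀ {x} → x ∈ V → ∀ c → x L.* lincomb c β ∈ V ∙ β
    *∈∙ {n = n} β sV {x} x∈V c = (λ i → ι (c i) L.* x) , (λ i → IsSubspace.*∈ sV (c i) x∈V) ,
      L.trans (*-distribˡ-sum x (λ i → ι (c i) L.* β i)) (sum-cong-≋ {n} (λ i →
        L.trans (L.sym (L.*-assoc _ _ _)) (L.*-congʳ (L.*-comm _ _))))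

    -- The spanning family consists of all products of a basis vector of `V` with a member of `β`,
    -- collected one member of `β` at a time.
    ∙-spanned : ∀ (β : Fin n → L.Carrier) → HasDim V d →
      ∃[ m ] Σ[ v ∈ (Fin m → L.Carrier) ] (∀ {z} → z ∈ V ∙ β → ∃[ c ] z L.≈ lincomb c v)
    ∙-spanned {n = zero}  β h = 0 , (λ ()) , λ (_ , _ , z≈0) → (λ ()) , z≈0
    ∙-spanned {n = suc n} β h =
      let m , v , span = ∙-spanned (β ∘ suc) h in
      _ , (λ i → basis i L.* β zero) ++ v , λ (x , x∈V , z≈) →
        let c , x₀≈ = spanning (x∈V zero)
            c′ , t≈ = span (x ∘ suc , x∈V ∘ suc , L.refl)
        in c ++ c′ , L.trans z≈ (L.trans
             (L.+-cong (L.trans (L.*-congʳ x₀≈) (lincomb-*ʳ c basis (β zero))) t≈)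
             (L.sym (lincomb-++ c c′ (λ i → basis i L.* β zero) v)))
      where open HasDim h

    ∙-dim : ∀ (β : Fin n → L.Carrier) → HasDim V d → ∃[ e ] HasDim (V ∙ β) e
    ∙-dim β h = let _ , v , span = ∙-spanned β h in hasDim (steinitz v span)

    -- Hyperplanes and products modulo a hyperplane.

    ⊞-sub : ∀ (w : Fin n → L.Carrier) → IsSubspace V → IsSubspace (V ⊞ w)
    ⊞-sub {n = n} w sV = record
      { resp = λ x≈y (v , c , v∈V , x≈) → v , c , v∈V , L.trans (L.sym x≈y) x≈
      ; 0∈   = L.0# , (λ _ → K.0#) , 0∈ ,
               L.sym (L.trans (L.+-identityˡ _) (lincomb-0 {n} _ w (λ _ → K.refl)))
      ; +∈   = λ (v , c , v∈V , x≈) (v′ , c′ , v′∈V , y≈) →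
                 v L.+ v′ , (λ i → c i K.+ c′ i) , +∈ v∈V v′∈V ,
                 L.trans (L.+-cong x≈ y≈) (L.trans (interchange _ _ _ _) (L.+-congˡ (L.sym (lincomb-+ c c′ w))))
      ; *∈   = λ s (v , c , v∈V , x≈) →
                 ι s L.* v , (λ i → s K.* c i) , *∈ s v∈V ,
                 L.trans (L.*-congˡ x≈) (L.trans (L.distribˡ _ _ _) (L.+-congˡ (L.sym (lincomb-*ˡ s c w))))
      }
      where open IsSubspace sV

  -- Stands for a nonzero linear form on `U` with kernel `N`, the coefficient along `line` being its
  -- value. The line is a family over `Fin 1` so that `_⊞_` and `lincomb` apply to it.
  record Hyperplane (N : Pred L.Carrier p) (U : Pred L.Carrier q) : Set (p ⊔ q ⊔ k ⊔ l ⊔ ℓl) where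
    field
      isSubspace : IsSubspace N
      N⊆U        : N ⊆ U
      U⊈N        : ¬ U ⊆ N
      line       : Fin 1 → L.Carrier
      U⊆N⊞line   : U ⊆ N ⊞ line

  abstract

    -- All but the first vector of a basis of `U` modulo `V` are added to `V`; the first one becomes
    -- the line.
    hyperplane : ∀ {V : Pred L.Carrier p} {U : Pred L.Carrier q} → IsSubspace V → IsSubspace U →
      V ⊆ U → ¬ U ⊆ V → HasDim U n → Σ[ N ∈ Pred L.Carrier (p ⊔ k ⊔ l ⊔ ℓl) ] (Hyperplane N U × V ⊆ N)
    hyperplane {V = V} {U = U} sV sU V⊆U U⊈V hU with relativeBasis sV (hasDim⇒bounded hU)
    ... | zero  , g = ⊥-elim (U⊈V λ x∈U → let v , c , v∈V , x≈ = RelativeBasis.spanning g x∈U in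
            IsSubspace.resp sV (L.sym (L.trans x≈ (L.+-identityʳ v))) v∈V)
    ... | suc d , g = V ⊞ (basis ∘ suc) , record
            { isSubspace = ⊞-sub (basis ∘ suc) sV
            ; N⊆U        = λ (v , c , v∈V , x≈) → IsSubspace.resp sU (L.sym x≈)
                (IsSubspace.+∈ sU (V⊆U v∈V) (lincomb∈ sU c (basis ∘ suc) (basis∈ ∘ suc)))
            ; U⊈N        = λ U⊆N → e∉N (U⊆N (basis∈ zero))
            ; line       = λ _ → basis zero
            ; U⊆N⊞line   = λ x∈U → let v , c , v∈V , x≈ = spanning x∈U in
                v L.+ lincomb (c ∘ suc) (basis ∘ suc) , (λ _ → c zero) ,
                (v , c ∘ suc , v∈V , L.refl) ,
                L.trans x≈ (L.trans (L.+-congˡ (L.trans (L.+-comm _ _) (L.+-congˡ (L.sym (L.+-identityʳ _)))))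
                                    (L.sym (L.+-assoc _ _ _)))
            } , λ {v} v∈V → v , (λ _ → K.0#) , v∈V ,
                  L.sym (L.trans (L.+-congˡ (lincomb-0 {d} _ (basis ∘ suc) (λ _ → K.refl))) (L.+-identityʳ v))
      where
      open RelativeBasis g
      open RingProperties L.ring using (-1*x≈-x)
      open RingProperties K.ring using (-‿involutive; -0#≈0#)
      e∉N : ¬ basis zero ∈ V ⊞ (basis ∘ suc)
      e∉N (v , c , v∈V , e≈) = KF.1≉0 (K.trans (K.sym (-‿involutive K.1#))
        (K.trans (K.-‿cong (independent (K.- K.1# ∷ c) dependency∈V zero)) -0#≈0#))
        where
        S : L.Carrier
        S = lincomb c (basis ∘ suc)
        -- If the first basis vector were in `N`, this relation modulo `V` would have first
        -- coefficient -1, against independence.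
        dependency∈V : lincomb (K.- K.1# ∷ c) basis ∈ V
        dependency∈V = cancel∈ sV v∈V (IsSubspace.resp sV (L.sym (begin
          v L.+ (ι (K.- K.1#) L.* basis zero L.+ S)  ≈⟨ L.+-congˡ (L.+-comm _ _) ⟩
          v L.+ (S L.+ ι (K.- K.1#) L.* basis zero)  ≈⟨ L.+-assoc _ _ _ ⟨
          v L.+ S L.+ ι (K.- K.1#) L.* basis zero
            ≈⟨ L.+-cong (L.sym e≈) (L.trans (L.*-congʳ (L.trans (-‿homo K.1#) (L.-‿cong 1#-homo))) (-1*x≈-x _)) ⟩
          basis zero L.- basis zero                  ≈⟨ L.-‿inverseʳ _ ⟩
          L.0#                                       ∎)) (IsSubspace.0∈ sV))

  module _ {N : Pred L.Carrier p} {U : Pred L.Carrier q} (H : Hyperplane N U) where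
    open Hyperplane H

    -- Each product has a single coordinate along `line`, so the requirement amounts to `n` linear
    -- equations in `d` unknowns.
    combination-into-hyperplane :
      (w : Fin d → L.Carrier) (v : Fin n → L.Carrier) → (∀ i j → w j L.* v i ∈ U) → n < d →
      Σ[ c ∈ (Fin d → K.Carrier) ] (¬ (∀ j → c j K.≈ K.0#) × ∀ i → lincomb c w L.* v i ∈ N)
    combination-into-hyperplane {d} {n} w v wv∈U n<d =
      let c , c≉0 , Mc≈0 = KF.underdetermined (λ i j → M i j zero) n<d
      in c , c≉0 , λ i → IsSubspace.resp isSubspace (L.sym (begin
        lincomb c w L.* v i                             ≈⟨ lincomb-*ʳ c w (v i) ⟩
        lincomb c (λ j → w j L.* v i)                   ≈⟨ lincomb-cong {d} (λ _ → K.refl) (λ j → decomposition i j) ⟩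
        lincomb c (λ j → u i j L.+ lincomb (M i j) line)
          ≈⟨ L.trans (sum-cong-≋ {d} (λ j → L.distribˡ _ _ _))
                     (∑-distrib-+ (λ j → ι (c j) L.* u i j) (λ j → ι (c j) L.* lincomb (M i j) line)) ⟩
        lincomb c (u i) L.+ lincomb c (λ j → lincomb (M i j) line)
          ≈⟨ L.+-congˡ (L.trans (lincomb-lincomb c (λ o j → M i j o) line)
               (lincomb-0 (λ o → ∑K.sum (λ j → M i j o K.* c j)) line (λ { zero → Mc≈0 i }))) ⟩
        lincomb c (u i) L.+ L.0#                        ≈⟨ L.+-identityʳ _ ⟩
        lincomb c (u i)                                 ∎))
        (lincomb∈ isSubspace c (u i) (u∈N i))
      where
      u : Fin n → Fin d → L.Carrier
      u i j = proj₁ (U⊆N⊞line (wv∈U i j))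
      M : Fin n → Fin d → Fin 1 → K.Carrier
      M i j = proj₁ (proj₂ (U⊆N⊞line (wv∈U i j)))
      u∈N : ∀ i j → u i j ∈ N
      u∈N i j = proj₁ (proj₂ (proj₂ (U⊆N⊞line (wv∈U i j))))
      decomposition : ∀ i j → w j L.* v i L.≈ u i j L.+ lincomb (M i j) line
      decomposition i j = proj₂ (proj₂ (proj₂ (U⊆N⊞line (wv∈U i j))))

-- The powers of `B` and the algebra they generate.

module PowerDimension (em : ∀ {ℓ} → ExcludedMiddle ℓ)
    {k ℓk ak l ℓl al p : Level} (E : FieldExtension k ℓk ak l ℓl al)
    (B : Pred (FieldExtension.L.Carrier E) p) {dB : ℕ}
    (hB : Extension.HasDim E B dB) (1∈B : B (FieldExtension.L.1# E)) where

  open Extension E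
  open LinearAlgebra em E
  open SumProperties L.semiring using (sum-cong-≋; *-distribˡ-sum)
  open CommutativeSemigroupProperties L.*-commutativeSemigroup using (x∙yz≈y∙xz)
  open CommutativeSemigroupProperties ℕ.+-commutativeSemigroup
    using () renaming (interchange to ℕ-interchange)

  -- A level preserved by all the constructions applied to fragments (intersection, sum, multiple,
  -- dual), so that one minimisation ranges over all of them.
  q : Level
  q = k ⊔ l ⊔ ℓl ⊔ p

  β : Fin dB → L.Carrier
  β = HasDim.basis hB

  W : ℕ → Pred L.Carrier q
  W j = Span (B ^ j)

  -- This is the algebra `K[B]`, possibly of infinite dimension; `1 ∈ B` makes the `W j` an
  -- increasing chain, so the union is a subspace.
  U : Pred L.Carrier q
  U x = ∃[ j ] x ∈ W j

  record Admissible (X : Pred L.Carrier q) : Set (k ⊔ ℓk ⊔ l ⊔ ℓl ⊔ q) where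
    field
      isSubspace : IsSubspace X
      X⊆U        : X ⊆ U
      nontrivial : ¬ X ⊆ 𝟎
      proper     : ¬ U ⊆ X ∙ β

  -- κ is dim XB − dim X.
  Fragment : ℕ → ℕ → Set _
  Fragment κ r = Σ[ X ∈ Pred L.Carrier q ] (Admissible X × HasDim X r × HasDim (X ∙ β) (κ ℕ.+ r))

  abstract

    W-sub : ∀ j → IsSubspace (W j)
    W-sub j = Span-sub (B ^ j)

    1∈W₀ : L.1# ∈ W 0
    1∈W₀ = ⊆-Span (B ^ 0) ((λ ()) , (λ ()) , L.refl)

    *∈W : ∀ j {x y} → x ∈ W j → y ∈ B → x L.* y ∈ W (suc j)
    *∈W j {x} {y} (n , c , s , s∈ , x≈) y∈B = IsSubspace.resp (W-sub (suc j))
      (L.sym (L.trans (L.*-congʳ x≈) (lincomb-*ʳ c s y)))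
      (lincomb∈ (W-sub (suc j)) c (λ i → s i L.* y) λ i → let b , b∈B , s≈ = s∈ i in
        ⊆-Span (B ^ suc j) (y ∷ b , (λ { zero → y∈B ; (suc h) → b∈B h }) ,
          L.trans (L.*-comm _ _) (L.*-congˡ s≈)))

    *∈∙β : ∀ {v} {V : Pred L.Carrier v} {x y} → IsSubspace V → x ∈ V → y ∈ B → x L.* y ∈ V ∙ β
    *∈∙β sV x∈V y∈B = let c , y≈ = HasDim.spanning hB y∈B in
      IsSubspace.resp (∙-sub β sV) (L.*-congˡ (L.sym y≈)) (*∈∙ β sV x∈V c)

    ⊆∙β : ∀ {v} {V : Pred L.Carrier v} → IsSubspace V → V ⊆ V ∙ β
    ⊆∙β sV x∈V = IsSubspace.resp (∙-sub β sV) (L.*-identityʳ _) (*∈∙β sV x∈V 1∈B)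

    W-suc-⊆ : ∀ j → W (suc j) ⊆ W j ∙ β
    W-suc-⊆ j = Span-⊆ {S = B ^ suc j} (∙-sub β (W-sub j)) λ (b , b∈B , x≈) →
      IsSubspace.resp (∙-sub β (W-sub j)) (L.sym (L.trans x≈ (L.*-comm _ _)))
        (*∈∙β (W-sub j) (⊆-Span (B ^ j) (b ∘ suc , b∈B ∘ suc , L.refl)) (b∈B zero))

    W-suc-⊇ : ∀ j → W j ∙ β ⊆ W (suc j)
    W-suc-⊇ j = ∙-⊆ β (W-sub (suc j)) (λ i x∈W → *∈W j x∈W (HasDim.basis∈ hB i))

    W-⊆-suc : ∀ j → W j ⊆ W (suc j)
    W-⊆-suc j x∈W = IsSubspace.resp (W-sub (suc j)) (L.*-identityʳ _) (*∈W j x∈W 1∈B)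

    W-⊆-+ : ∀ i j → W j ⊆ W (i ℕ.+ j)
    W-⊆-+ zero    j x∈W = x∈W
    W-⊆-+ (suc i) j x∈W = W-⊆-suc (i ℕ.+ j) (W-⊆-+ i j x∈W)

    U-sub : IsSubspace U
    U-sub = record
      { resp = λ x≈y (j , x∈W) → j , IsSubspace.resp (W-sub j) x≈y x∈W
      ; 0∈   = 0 , IsSubspace.0∈ (W-sub 0)
      ; +∈   = λ {x} {y} (i , x∈W) (j , y∈W) → i ℕ.+ j , IsSubspace.+∈ (W-sub (i ℕ.+ j))
                 (≡.subst (λ h → x ∈ W h) (ℕ.+-comm j i) (W-⊆-+ j i x∈W)) (W-⊆-+ i j y∈W)
      ; *∈   = λ c (j , x∈W) → j , IsSubspace.*∈ (W-sub j) c x∈W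
      }

    U-*B : ∀ {x y} → x ∈ U → y ∈ B → x L.* y ∈ U
    U-*B (j , x∈W) y∈B = suc j , *∈W j x∈W y∈B

    ∙β⊆U : ∀ {v} {V : Pred L.Carrier v} → V ⊆ U → V ∙ β ⊆ U
    ∙β⊆U V⊆U = ∙-⊆ β U-sub (λ i x∈V → U-*B (V⊆U x∈V) (HasDim.basis∈ hB i))

    1∈U : L.1# ∈ U
    1∈U = 0 , 1∈W₀

    W-nontrivial : ∀ j → ¬ W j ⊆ 𝟎
    W-nontrivial j W⊆𝟎 = LF.1≉0 (W⊆𝟎 (≡.subst (λ h → L.1# ∈ W h) (ℕ.+-identityʳ j)
      (W-⊆-+ j 0 1∈W₀)))

    -- A subspace stable under `B` is a module over `U`: the factors from `B` are absorbed one at a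
    -- time, down to `W 0`, which is `K`. Applied to `U` itself, this makes `U` a ring.
    stable-W : ∀ {v} {V : Pred L.Carrier v} → IsSubspace V → V ∙ β ⊆ V →
               ∀ j {x y} → x ∈ V → y ∈ W j → x L.* y ∈ V
    stable-W sV Vβ⊆V zero x∈V y∈W =
      let c , y≈ = proj₁ (span-^0 B) y∈W in
      IsSubspace.resp sV (L.trans (L.*-comm _ _) (L.*-congˡ (L.sym y≈))) (IsSubspace.*∈ sV c x∈V)
    stable-W sV Vβ⊆V (suc j) {x} x∈V y∈W =
      let t , t∈W , y≈ = W-suc-⊆ j y∈W in
      IsSubspace.resp sV
        (L.sym (L.trans (L.*-congˡ y≈) (L.trans (*-distribˡ-sum x (λ i → t i L.* β i))
          (sum-cong-≋ {dB} (λ i → L.sym (L.*-assoc x (t i) (β i)))))))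
        (Vβ⊆V ((λ i → x L.* t i) , (λ i → stable-W sV Vβ⊆V j x∈V (t∈W i)) , L.refl))

    U-* : ∀ {x y} → x ∈ U → y ∈ U → x L.* y ∈ U
    U-* x∈U (j , y∈W) = stable-W U-sub (∙β⊆U (λ x∈ → x∈)) j x∈U y∈W

    W-dim : ∀ j → ∃[ d ] HasDim (W j) d
    W-dim zero = hasDim (steinitz {n = 1} (λ _ → L.1#) λ x∈W →
      let a , x≈ = proj₁ (span-^0 B) x∈W in
      (λ _ → a) , L.trans x≈ (L.sym (L.trans (L.+-identityʳ _) (L.*-identityʳ _))))
    W-dim (suc j) = let e , h = ∙-dim β (proj₂ (W-dim j)) in e , dim-≐ (W-suc-⊇ j) (W-suc-⊆ j) h

    fragment : ∀ {X r e} → Admissible X → HasDim X r → HasDim (X ∙ β) e →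
               ∃[ κ ] (Fragment κ r × κ ℕ.+ r ≡ e)
    -- The truncated subtraction is exact, since `1 ∈ B` gives `X ⊆ X ∙ β` and hence `r ≤ e`.
    fragment {X} {r} {e} adm hX hXB = e ℕ.∸ r , (X , adm , hX , ≡.subst (HasDim (X ∙ β)) (≡.sym e≡) hXB) , e≡
      where
      e≡ : e ℕ.∸ r ℕ.+ r ≡ e
      e≡ = ℕ.m∸n+n≡m (dim-mono (⊆∙β (Admissible.isSubspace adm)) hX hXB)

    -- `X` and `Y` are orthogonal for the form `xy` modulo `N`. If `X` had dimension above the
    -- codimension of `Y`, some nonzero `x` in `X` would also send representatives of `U / Y` into
    -- `N`, hence all of `U`; by `absorb` this forces `U ⊆ N`.
    orthogonal-dim : ∀ {v w n m r s} {N : Pred L.Carrier n} {X : Pred L.Carrier v} {Y : Pred L.Carrier w} →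
      Hyperplane N U → HasDim U m → IsSubspace Y → X ⊆ U → Y ⊆ U → HasDim X r → HasDim Y s →
      (∀ {x y} → x ∈ X → y ∈ Y → x L.* y ∈ N) → s ℕ.+ r ≤ m
    orthogonal-dim {m = m} {r} {s} {N} {X} {Y} H hU sY X⊆U Y⊆U hX hY XY⊆N =
      let t , g = relativeBasis sY (hasDim⇒bounded hU)
      in ≡.subst (s ℕ.+ r ≤_) (dim-unique (relative-dim sY Y⊆U hY g) hU)
                 (ℕ.+-monoʳ-≤ s (r≤t g))
      where
      open Hyperplane H
      open HasDim hX
      module N = IsSubspace isSubspace
      r≤t : ∀ {t} → RelativeBasis Y U t → r ≤ t
      r≤t g = ℕ.≮⇒≥ λ t<r →
        let module g = RelativeBasis g
            c , c≉0 , xg∈N = combination-into-hyperplane H basis g.basis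
              (λ i j → U-* (X⊆U (basis∈ j)) (g.basis∈ i)) t<r
            x = lincomb c basis
            x∈X : x ∈ U
            x∈X = lincomb∈ U-sub c basis (X⊆U ∘ basis∈)
            xY⊆N : ∀ {y} → y ∈ Y → x L.* y ∈ N
            xY⊆N {y} y∈Y = N.resp (L.sym (lincomb-*ʳ c basis y))
              (lincomb∈ isSubspace c (λ i → basis i L.* y) (λ i → XY⊆N (basis∈ i) y∈Y))
            xU⊆N : ∀ {u} → u ∈ U → x L.* u ∈ N
            xU⊆N u∈U = let y , c′ , y∈Y , u≈ = g.spanning u∈U in
              N.resp (L.sym (L.trans (L.*-congˡ u≈) (L.trans (L.distribˡ x y _)
                             (L.+-congˡ (L.sym (lincomb-scale x c′ g.basis))))))
                (N.+∈ (xY⊆N y∈Y) (lincomb∈ isSubspace c′ (λ i → x L.* g.basis i) xg∈N))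
        in c≉0 (independent c (decidable-stable em λ x≉0 →
             U⊈N (absorb isSubspace N⊆U (proj₂ (dim-⊆ N⊆U hU)) x≉0 xU⊆N)))

  -- Atoms: fragments minimising the gap and then the dimension.

  module Atom {κ a} {A : Pred L.Carrier q} (A-adm : Admissible A)
              (hA : HasDim A a) (hAB : HasDim (A ∙ β) (κ ℕ.+ a))
              (κ-min : ∀ m b → Fragment m b → κ ≤ m) (a-min : ∀ b → Fragment κ b → a ≤ b) where

    open Admissible A-adm renaming (isSubspace to sA; X⊆U to A⊆U)

    -- For a hyperplane N of U, the annihilator of AB under the form U × U → U / N.
    Dual : ∀ {n} → Pred L.Carrier n → Pred L.Carrier (n ⊔ q)
    Dual N y = y ∈ U × (∀ {z} → z ∈ A ∙ β → y L.* z ∈ N)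

    abstract

      Dual-sub : ∀ {n} {N : Pred L.Carrier n} → IsSubspace N → IsSubspace (Dual N)
      Dual-sub sN = record
        { resp = λ x≈y (x∈U , xAB⊆N) → U.resp x≈y x∈U , λ z∈ → N.resp (L.*-congʳ x≈y) (xAB⊆N z∈)
        ; 0∈   = U.0∈ , λ {z} _ → N.resp (L.sym (L.zeroˡ z)) N.0∈
        ; +∈   = λ (x∈U , xAB⊆N) (y∈U , yAB⊆N) →
                   U.+∈ x∈U y∈U , λ z∈ → N.resp (L.sym (L.distribʳ _ _ _)) (N.+∈ (xAB⊆N z∈) (yAB⊆N z∈))
        ; *∈   = λ c (x∈U , xAB⊆N) →
                   U.*∈ c x∈U , λ z∈ → N.resp (L.sym (L.*-assoc _ _ _)) (N.*∈ c (xAB⊆N z∈))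
        }
        where
        module U = IsSubspace U-sub
        module N = IsSubspace sN

      -- With more than dim `AB` vectors independent modulo the dual, some nontrivial combination
      -- would multiply a basis of `AB` into `N` and so lie in the dual.
      Dual-codim : ∀ {n t} {N : Pred L.Carrier n} → Hyperplane N U → RelativeBasis (Dual N) U t → t ≤ κ ℕ.+ a
      Dual-codim {N = N} H g = ℕ.≮⇒≥ λ lt →
        let c , c≉0 , kills = combination-into-hyperplane H G.basis AB.basis
              (λ i j → U-* (G.basis∈ j) (∙β⊆U A⊆U (AB.basis∈ i))) lt
        in c≉0 (G.independent c (lincomb∈ U-sub c G.basis G.basis∈ , λ z∈AB →
             let e , z≈ = AB.spanning z∈AB in
             IsSubspace.resp isSubspace
               (L.trans (lincomb-scale _ e AB.basis) (L.*-congˡ (L.sym z≈)))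
               (lincomb∈ isSubspace e (λ i → lincomb c G.basis L.* AB.basis i) kills)))
        where
        open Hyperplane H
        module G = RelativeBasis g
        module AB = HasDim hAB

      a≢0 : ¬ a ≡ 0
      a≢0 a≡0 = nontrivial (dim-zero (≡.subst (HasDim A) a≡0 hA))

      -- The dual of A is itself admissible with a gap of at most κ, so by the
      -- minimality of A its dimension is at least a.
      finite-bound : ∀ {m} → HasDim U m → κ ℕ.+ a ℕ.+ a ≤ m
      finite-bound {m} hU =
        let N , H , _ = hyperplane (∙-sub β sA) U-sub (∙β⊆U A⊆U) proper hU
            sN = Hyperplane.isSubspace H
            sD = Dual-sub sN
            D⊆U : Dual N ⊆ U
            D⊆U = proj₁
            b , hD = dim-⊆ D⊆U hU
            t , g = relativeBasis sD (hasDim⇒bounded hU)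
            b+t≡m : b ℕ.+ t ≡ m
            b+t≡m = dim-unique (relative-dim sD D⊆U hD g) hU
            t≤κ+a = Dual-codim H g
            e , hDB = ∙-dim β hD
            e+a≤m : e ℕ.+ a ≤ m
            -- The dual is orthogonal to `AB`, so its product with `B` is orthogonal to `A`: the
            -- factor `β i` moves across the form.
            e+a≤m = orthogonal-dim H hU (∙-sub β sD) A⊆U (∙β⊆U D⊆U) hA hDB
              λ {x} x∈A (y , y∈D , z≈) → IsSubspace.resp sN
                (L.sym (L.trans (L.*-congˡ z≈) (*-distribˡ-sum x (λ i → y i L.* β i))))
                (sum∈ sN (λ i → x L.* (y i L.* β i)) λ i → IsSubspace.resp sN
                  (x∙yz≈y∙xz (y i) x (β i))
                  (proj₂ (y∈D i) (*∈∙β sA x∈A (HasDim.basis∈ hB i))))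
            D-adm : Admissible (Dual N)
            D-adm = record
              { isSubspace = sD
              ; X⊆U        = D⊆U
              -- A zero dual has codimension `m`, so `m ≤ κ + a` and `AB` would fill `U`.
              ; nontrivial = λ D⊆𝟎 → proper (dim-full (∙-sub β sA) (∙β⊆U A⊆U) hAB hU
                  (≡.subst (_≤ κ ℕ.+ a) (≡.trans (≡.cong (ℕ._+ t) (≡.sym (trivial-dim D⊆𝟎 hD))) b+t≡m) t≤κ+a))
              ; proper     = λ U⊆DB → a≢0 (ℕ.n≤0⇒n≡0 (ℕ.+-cancelˡ-≤ m a 0 (ℕ.≤-trans
                  (ℕ.+-monoˡ-≤ a (dim-mono U⊆DB hU hDB)) (ℕ.≤-trans e+a≤m (ℕ.≤-reflexive (≡.sym (ℕ.+-identityʳ m)))))))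
              }
            κ′ , D-fragment , κ′+b≡e = fragment D-adm hD hDB
            κ′+b+a≤m : κ′ ℕ.+ b ℕ.+ a ≤ m
            κ′+b+a≤m = ≡.subst (λ h → h ℕ.+ a ≤ m) (≡.sym κ′+b≡e) e+a≤m
            -- Equality is needed because `a-min` compares only fragments of gap exactly `κ`.
            κ′≡κ : κ′ ≡ κ
            κ′≡κ = ℕ.≤-antisym (cancel κ′ b t κ′+b+a≤m b+t≡m t≤κ+a) (κ-min κ′ b D-fragment)
            a≤b : a ≤ b
            a≤b = a-min b (≡.subst (λ h → Fragment h b) κ′≡κ D-fragment)
        in ℕ.≤-trans (ℕ.+-monoˡ-≤ a (ℕ.+-mono-≤ (κ-min κ′ b D-fragment) a≤b)) κ′+b+a≤m
        where
        open ℕ.≤-Reasoning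
        cancel : ∀ κ′ b t → κ′ ℕ.+ b ℕ.+ a ≤ m → b ℕ.+ t ≡ m → t ≤ κ ℕ.+ a → κ′ ≤ κ
        cancel κ′ b t κ′+b+a≤m ≡.refl t≤κ+a = ℕ.+-cancelʳ-≤ (b ℕ.+ a) κ′ κ (begin
          κ′ ℕ.+ (b ℕ.+ a)  ≡⟨ ℕ.+-assoc κ′ b a ⟨
          κ′ ℕ.+ b ℕ.+ a    ≤⟨ κ′+b+a≤m ⟩
          b ℕ.+ t           ≤⟨ ℕ.+-monoʳ-≤ b t≤κ+a ⟩
          b ℕ.+ (κ ℕ.+ a)   ≡⟨ ℕ.+-assoc b κ a ⟨
          b ℕ.+ κ ℕ.+ a     ≡⟨ ≡.cong (ℕ._+ a) (ℕ.+-comm b κ) ⟩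
          κ ℕ.+ b ℕ.+ a     ≡⟨ ℕ.+-assoc κ b a ⟩
          κ ℕ.+ (b ℕ.+ a)   ∎)

      -- Submodularity for `I = A ∩ bA` and `S = A + bA`: since `IB` lies in `AB ∩ bAB` and `SB` in
      -- `AB + bAB`, two uses of `grassmann` bound the sum of the gaps of `I` and `S` by `2κ`.
      translate-⊆ : ∀ {b} → b ∈ B → ¬ (A ∩ b ⋆ A) ⊆ 𝟎 → b ⋆ A ⊆ A
      translate-⊆ {b} b∈B I⊈𝟎 =
        let i , s , hI , hS , i+s≡a+a = grassmann sA sbA hA hbA
            eI , hIB = ∙-dim β hI
            eS , hSB = ∙-dim β hS
            e , hbAB = ∙-dim β hbA
            j , t , hj , ht , j+t≡ = grassmann (∙-sub β sA) (∙-sub β sbA) hAB hbAB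
            eI≤j : eI ≤ j
            eI≤j = dim-mono (λ z∈ → ∙-mono {V = A ∩ b ⋆ A} {W = A} β proj₁ z∈ ,
                                    ∙-mono {V = A ∩ b ⋆ A} {W = b ⋆ A} β proj₂ z∈) hIB hj
            eS≤t : eS ≤ t
            eS≤t = dim-mono (∙-⊆ β (⊕-sub (∙-sub β sA) (∙-sub β sbA)) SB⊆) hSB ht
            e≤κ+a : e ≤ κ ℕ.+ a
            e≤κ+a = dim-mono (∙-⊆ β (⋆-sub b (∙-sub β sA)) bAB⊆) hbAB (⋆-dim b≉0 hAB)
            κI , I-fragment , κI+i≡eI = fragment I-adm hI hIB
            κ+s≤eS : κ ℕ.+ s ≤ eS
            κ+s≤eS = S-bound hS hSB i+s≡a+a em
        in λ z∈bA → proj₁ (dim-full (∩-sub sA sbA) proj₂ hI hbA (ℕ.≮⇒≥ λ i<a →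
             -- A nonzero intersection smaller than `A` has gap at least `κ`, and not equal to it by
             -- minimality of `a`. Together with at least `κ` for the sum, this exceeds `2κ`.
             let κ<κI : κ < κI
                 κ<κI = ℕ.≤∧≢⇒< (κ-min κI i I-fragment) λ κ≡κI →
                   ℕ.<⇒≱ i<a (a-min i (≡.subst (λ h → Fragment h i) (≡.sym κ≡κI) I-fragment))
             in contra i+s≡a+a
                  (ℕ.≤-trans (ℕ.+-monoˡ-≤ i κ<κI) (ℕ.≤-trans (ℕ.≤-reflexive κI+i≡eI) eI≤j))
                  (ℕ.≤-trans κ+s≤eS eS≤t) (ℕ.≤-trans (ℕ.≤-reflexive j+t≡) (ℕ.+-monoʳ-≤ (κ ℕ.+ a) e≤κ+a)))
             z∈bA)
        where
        b≉0 : ¬ b L.≈ L.0#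
        b≉0 b≈0 = I⊈𝟎 λ (_ , v , _ , z≈) → L.trans z≈ (L.trans (L.*-congʳ b≈0) (L.zeroˡ v))
        sbA : IsSubspace (b ⋆ A)
        sbA = ⋆-sub b sA
        hbA : HasDim (b ⋆ A) a
        hbA = ⋆-dim b≉0 hA
        bA⊆U : b ⋆ A ⊆ U
        bA⊆U (v , v∈A , z≈) = IsSubspace.resp U-sub (L.trans (L.*-comm v b) (L.sym z≈)) (U-*B (A⊆U v∈A) b∈B)
        bAB⊆ : ∀ {x} i → x ∈ b ⋆ A → x L.* β i ∈ b ⋆ (A ∙ β)
        bAB⊆ i (v , v∈A , x≈) = v L.* β i , *∈∙β sA v∈A (HasDim.basis∈ hB i) ,
          L.trans (L.*-congʳ x≈) (L.*-assoc b v (β i))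
        SB⊆ : ∀ {x} i → x ∈ A ⊕ b ⋆ A → x L.* β i ∈ (A ∙ β) ⊕ ((b ⋆ A) ∙ β)
        SB⊆ i (x , y , x∈A , y∈bA , z≈) = x L.* β i , y L.* β i ,
          *∈∙β sA x∈A (HasDim.basis∈ hB i) , *∈∙β sbA y∈bA (HasDim.basis∈ hB i) ,
          L.trans (L.*-congʳ z≈) (L.distribʳ (β i) x y)
        I-adm : Admissible (A ∩ b ⋆ A)
        I-adm = record
          { isSubspace = ∩-sub sA sbA
          ; X⊆U        = A⊆U ∘ proj₁
          ; nontrivial = I⊈𝟎
          ; proper     = λ U⊆IB → proper (λ u∈U → ∙-mono {V = A ∩ b ⋆ A} {W = A} β proj₁ (U⊆IB u∈U))
          }
        S⊆U : A ⊕ b ⋆ A ⊆ U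
        S⊆U = ⊕-⊆ U-sub A⊆U bA⊆U
        S-bound : ∀ {i s eS} → HasDim (A ⊕ b ⋆ A) s → HasDim ((A ⊕ b ⋆ A) ∙ β) eS →
                  i ℕ.+ s ≡ a ℕ.+ a → Dec (U ⊆ (A ⊕ b ⋆ A) ∙ β) → κ ℕ.+ s ≤ eS
        -- When `SB` fills `U`, the sum is not admissible and `κ-min` is silent; `finite-bound`
        -- replaces it, as `s` is at most `a + a`.
        S-bound {i} {s} hS hSB i+s≡a+a (yes U⊆SB) = ℕ.≤-trans
          (ℕ.+-monoʳ-≤ κ (ℕ.≤-trans (ℕ.m≤n+m s i) (ℕ.≤-reflexive i+s≡a+a)))
          (ℕ.≤-trans (ℕ.≤-reflexive (≡.sym (ℕ.+-assoc κ a a)))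
            (finite-bound (dim-≐ (∙β⊆U S⊆U) U⊆SB hSB)))
        S-bound {i} {s} hS hSB _ (no U⊈SB) =
          let κS , S-fragment , κS+s≡eS = fragment (record
                { isSubspace = ⊕-sub sA sbA
                ; X⊆U        = S⊆U
                ; nontrivial = λ S⊆𝟎 → nontrivial (λ x∈A → S⊆𝟎 (⊕-inˡ sbA x∈A))
                ; proper     = U⊈SB
                }) hS hSB
          in ℕ.≤-trans (ℕ.+-monoˡ-≤ s (κ-min κS s S-fragment)) (ℕ.≤-reflexive κS+s≡eS)
        contra : ∀ {i s j t} → i ℕ.+ s ≡ a ℕ.+ a → suc κ ℕ.+ i ≤ j → κ ℕ.+ s ≤ t →
                 j ℕ.+ t ≤ (κ ℕ.+ a) ℕ.+ (κ ℕ.+ a) → ⊥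
        contra {i} {s} {j} {t} i+s≡a+a j-large t-large total = ℕ.<-irrefl ≡.refl (begin-strict
          (κ ℕ.+ a) ℕ.+ (κ ℕ.+ a)  ≡⟨ ℕ-interchange κ a κ a ⟩
          (κ ℕ.+ κ) ℕ.+ (a ℕ.+ a)  ≡⟨ ≡.cong (κ ℕ.+ κ ℕ.+_) i+s≡a+a ⟨
          (κ ℕ.+ κ) ℕ.+ (i ℕ.+ s)  ≡⟨ ℕ-interchange κ κ i s ⟩
          (κ ℕ.+ i) ℕ.+ (κ ℕ.+ s)  <⟨ ℕ.+-mono-<-≤ j-large t-large ⟩
          j ℕ.+ t                  ≤⟨ total ⟩
          (κ ℕ.+ a) ℕ.+ (κ ℕ.+ a)  ∎)
          where open ℕ.≤-Reasoning

      half-bound : dB ≤ κ ℕ.+ κ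
      half-bound =
        let x , x∈A , x≉0 = nonzero nontrivial
            dB≤κ+a : dB ≤ κ ℕ.+ a
            dB≤κ+a = dim-mono (λ (v , v∈B , z≈) →
              IsSubspace.resp (∙-sub β sA) (L.sym z≈) (*∈∙β sA x∈A v∈B)) (⋆-dim x≉0 hB) hAB
            -- If `bA ⊆ A` for every `b` in `B`, then `A` would be a module over `U` containing
            -- `xU`, and `absorb` would give `U ⊆ A ⊆ AB`.
            b , b∈B , bA⊈A = decidable-stable (em {P = ∃[ b ] (b ∈ B × ¬ b ⋆ A ⊆ A)}) λ none →
              let stable : A ∙ β ⊆ A
                  stable = ∙-⊆ β sA λ {v} i v∈A → decidable-stable em λ vβ∉A →
                    none (β i , HasDim.basis∈ hB i , λ βA⊆A → vβ∉A (βA⊆A (v , v∈A , L.*-comm v (β i))))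
              in proper (λ u∈U → ⊆∙β sA (absorb sA A⊆U hA x≉0
                   (λ (j , u∈W) → stable-W sA stable j x∈A u∈W) u∈U))
            sbA = ⋆-sub b sA
            b≉0 : ¬ b L.≈ L.0#
            b≉0 b≈0 = bA⊈A λ (v , _ , z≈) → IsSubspace.resp sA
              (L.sym (L.trans z≈ (L.trans (L.*-congʳ b≈0) (L.zeroˡ v)))) (IsSubspace.0∈ sA)
            I⊆𝟎 : A ∩ b ⋆ A ⊆ 𝟎
            I⊆𝟎 = decidable-stable em (λ I⊈𝟎 → bA⊈A (translate-⊆ b∈B I⊈𝟎))
            i , s , hI , hS , i+s≡a+a = grassmann sA sbA hA (⋆-dim b≉0 hA)
            -- Both `1` and `b` belong to `B`; as the sum is direct, its dimension `a + a` is at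
            -- most `κ + a`.
            S⊆AB : A ⊕ b ⋆ A ⊆ A ∙ β
            S⊆AB = ⊕-⊆ (∙-sub β sA) (⊆∙β sA) λ (v , v∈A , z≈) → IsSubspace.resp (∙-sub β sA)
              (L.trans (L.*-comm v b) (L.sym z≈)) (*∈∙β sA v∈A b∈B)
            a+a≤κ+a : a ℕ.+ a ≤ κ ℕ.+ a
            a+a≤κ+a = ≡.subst (_≤ κ ℕ.+ a) (≡.trans (≡.cong (ℕ._+ s) (≡.sym (trivial-dim I⊆𝟎 hI))) i+s≡a+a)
              (dim-mono S⊆AB hS hAB)
        in ℕ.≤-trans dB≤κ+a (ℕ.+-monoʳ-≤ κ (ℕ.+-cancelʳ-≤ a a κ a+a≤κ+a))

  -- The growth estimate for powers of `B`.

  abstract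

    -- The given fragment starts the two minimisations. The atom is then forgotten; only its gap and
    -- the bound on `dB` survive.
    expansion : ∀ {m b} → Fragment m b → ∃[ κ ] (dB ≤ κ ℕ.+ κ × (∀ m b → Fragment m b → κ ≤ m))
    expansion {m} {b} F =
      let κ , (b′ , F′) , κ-min = Extremal.minimum em (λ κ → ∃[ b ] Fragment κ b) m (b , F)
          a , (A , A-adm , hA , hAB) , a-min = Extremal.minimum em (Fragment κ) b′ F′
      in κ , Atom.half-bound A-adm hA hAB (λ m b F → κ-min m (b , F)) a-min , λ m b F → κ-min m (b , F)

    -- The index is shifted: `suc n` here is the exponent `n` of the theorem, so `W n` is the power
    -- below it.
    growth : ∀ n → ¬ W (suc (suc n)) ⊆ W (suc n) →
      ∃[ d⁺ ] ∃[ d⁻ ] (HasDim (W (suc (suc n))) d⁺ × HasDim (W n) d⁻ × d⁻ ℕ.+ dB ≤ d⁺)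
    growth n W⊈W =
      let d⁻ , h⁻ = W-dim n
          d₁ , h₁ = W-dim (suc n)
          d⁺ , h⁺ = W-dim (suc (suc n))
      in d⁺ , d⁻ , h⁺ , h⁻ , bound h⁻ h₁ h⁺ em
      where
      W⊆U : ∀ j → W j ⊆ U
      W⊆U j x∈W = j , x∈W
      U⊈W : ¬ U ⊆ W (suc n)
      U⊈W U⊆W = W⊈W (λ x∈W → U⊆W (W⊆U (suc (suc n)) x∈W))
      -- The product of `W j` with `B` is `W (suc j)`, so properness concerns the next power.
      adm : ∀ j → ¬ U ⊆ W (suc j) → Admissible (W j)
      adm j U⊈W = record
        { isSubspace = W-sub j
        ; X⊆U        = W⊆U j
        ; nontrivial = W-nontrivial j
        ; proper     = λ U⊆WB → U⊈W (λ u∈U → W-suc-⊇ j (U⊆WB u∈U))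
        }
      bound : ∀ {d⁻ d₁ d⁺} → HasDim (W n) d⁻ → HasDim (W (suc n)) d₁ → HasDim (W (suc (suc n))) d⁺ →
              Dec (U ⊆ W (suc (suc n))) → d⁻ ℕ.+ dB ≤ d⁺
      bound h⁻ h₁ h⁺ (yes U⊆W) =
        let hU = dim-≐ (W⊆U (suc (suc n))) U⊆W h⁺
            -- A hyperplane through `W (suc n)` contains every product of `B` with `W n`, which
            -- makes these two orthogonal.
            N , H , W⊆N = hyperplane (W-sub (suc n)) U-sub (W⊆U (suc n)) U⊈W hU
        in orthogonal-dim H hU (W-sub n)
             (λ x∈B → IsSubspace.resp U-sub (L.*-identityˡ _) (U-*B 1∈U x∈B)) (W⊆U n) hB h⁻
             (λ x∈B y∈W → W⊆N (IsSubspace.resp (W-sub (suc n)) (L.*-comm _ _) (*∈W n y∈W x∈B)))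
      bound {d⁻} {d₁} {d⁺} h⁻ h₁ h⁺ (no U⊈W′) =
        -- Here `W n` and `W (suc n)` are both admissible, so each of the two steps gains at least
        -- the minimal gap.
        let κ₁ , F₁ , κ₁+d₁≡d⁺ = fragment (adm (suc n) U⊈W′) h₁
              (dim-≐ (W-suc-⊆ (suc n)) (W-suc-⊇ (suc n)) h⁺)
            κ₀ , F₀ , κ₀+d⁻≡d₁ = fragment (adm n U⊈W) h⁻ (dim-≐ (W-suc-⊆ n) (W-suc-⊇ n) h₁)
            κ , dB≤κ+κ , κ-min = expansion F₁
        in begin
          d⁻ ℕ.+ dB           ≤⟨ ℕ.+-monoʳ-≤ d⁻ dB≤κ+κ ⟩
          d⁻ ℕ.+ (κ ℕ.+ κ)    ≤⟨ ℕ.+-monoʳ-≤ d⁻ (ℕ.+-mono-≤ (κ-min κ₁ d₁ F₁) (κ-min κ₀ d⁻ F₀)) ⟩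
          d⁻ ℕ.+ (κ₁ ℕ.+ κ₀)  ≡⟨ ℕ.+-comm d⁻ (κ₁ ℕ.+ κ₀) ⟩
          κ₁ ℕ.+ κ₀ ℕ.+ d⁻    ≡⟨ ℕ.+-assoc κ₁ κ₀ d⁻ ⟩
          κ₁ ℕ.+ (κ₀ ℕ.+ d⁻)  ≡⟨ ≡.cong (κ₁ ℕ.+_) κ₀+d⁻≡d₁ ⟩
          κ₁ ℕ.+ d₁           ≡⟨ κ₁+d₁≡d⁺ ⟩
          d⁺                  ∎
        where open ℕ.≤-Reasoning

open import Data.Nat.Base using (_+_; _∸_; _≥_)

mainTheorem14 : (∀ {ℓ} → ExcludedMiddle ℓ) →
    ∀ {k ℓk ak l ℓl al p : Level} (E : FieldExtension k ℓk ak l ℓl al) →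
    let open Extension E in
    (∀ α → Algebraic α → Separable α) →
    (B : Pred L.Carrier p) → IsSubspace B →
    (d : ℕ) → HasDim B d →
    L.1# ∈ B →
    (n : ℕ) → n ≥ 1 →
    (Span (B ^ suc n) ≐ Span (B ^ n))
    ⊎ (∃[ d⁺ ] ∃[ d⁻ ] ( HasDim (Span (B ^ suc n)) d⁺
    × HasDim (Span (B ^ (n ∸ 1))) d⁻
    × d⁺ ≥ d⁻ + d ))
mainTheorem14 em E _ B _ d hB 1∈B (suc n) _ = decide em
  where
  open Extension E
  open PowerDimension em E B hB 1∈B
  decide : Dec (W (suc (suc n)) ⊆ W (suc n)) →
    (Span (B ^ suc (suc n)) ≐ Span (B ^ suc n))
    ⊎ (∃[ d⁺ ] ∃[ d⁻ ] (HasDim (Span (B ^ suc (suc n))) d⁺ × HasDim (Span (B ^ n)) d⁻ × d⁺ ≥ d⁻ + d))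
  -- The reverse inclusion always holds because `1 ∈ B`.
  decide (yes W⊆W) = inj₁ (W⊆W , W-⊆-suc (suc n))
  decide (no  W⊈W) = inj₂ (growth n W⊈W)
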